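{- For every $\varepsilon>0$ there is $n_0$ such that every graph $G$ on $n\ge n_0$ vertices with $\alpha_7(G)\ge 3$ satisfies $\alpha(G)\ge n^{5/12-\varepsilon}$.
   Context: $\alpha(G)$ is the independence number of $G$. $\alpha_7(G)\ge 3$ means that every set of $7$ vertices of $G$ contains an independent set of size $3$. -}

module Defs where

open import Data.Nat using (ℕ; suc; _≤_; _^_)
open import Data.Bool using (Bool; true; false)
open import Data.Fin using (Fin)
open import Data.Fin.Subset using (Subset; _∈_; _⊆_; ∣_∣)
open import Data.Product using (Σ; _×_; ∃)
open import Relation.Binary.PropositionalEquality using (_≡_; _≢_)

record Graph (n : ℕ) : Set where
  field
    adj     : Fin n → Fin n → Bool
    adj-sym : ∀ i j → adj i j ≡ adj j i
    adj-irr : ∀ i → adj i i ≡ false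

open Graph public

Independent : ∀ {n} → Graph n → Subset n → Set
Independent G S = ∀ i j → i ∈ S → j ∈ S → adj G i j ≡ false

Alpha7≥3 : ∀ {n} → Graph n → Set
Alpha7≥3 {n} G = (S : Subset n) → ∣ S ∣ ≡ 7 →
  Σ (Subset n) λ T → T ⊆ S × ∣ T ∣ ≡ 3 × Independent G T

{-# OPTIONS --safe #-}

-- If G contains a K₄, the rest of G is triangle-free and a greedy argument suffices. Otherwise G has
-- no K₄ and no Moser spindle (a 7-vertex graph without independent triples). Suppose α(G) < k
-- and n > 22 k² r, where r⁵ ≈ 8 k². Call v and w good if the edges in N(v) ∩ N(w) are not covered by
-- two vertices. As there are no spindles, the vertices good for v form an independent set Γ(v), so
-- there are fewer than k of them; for pairs that are not good, |N(v) ∩ N(w)| ≤ 2k. Hence the number of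
-- (x; u₀, u, y) in N(x) with u₀u and uy good but u₀y not good is at most 2k³ on average over x.
-- On the other hand each link N(x) has at least kr vertices in a part where independent sets expand
-- by a factor of about r, and in it most paths of length two have good ends. Following walks of length
-- four from u₀ reaches r⁴ pairs (u, y) with u₀u and uy good, and few of these y fit into Γ(u₀).
-- This gives kr⁵ such configurations for most x, a contradiction; so n ≲ k² r ≈ k^(12/5).

module Submission where

open import Defs
import Algebra.Properties.CommutativeMonoid.Sum
open import Data.Bool using (Bool; true; false)
import Data.Bool.Properties as Bool
open import Data.Empty using (⊥)
open import Data.Fin using (Fin; zero; suc)
open import Data.Fin.Patterns
import Data.Fin.Properties as Fin
open import Data.Fin.Subset
  using (Subset; _∈_; _∉_; _⊆_; _∩_; _∪_; _─_; ⁅_⁆; ∣_∣; Nonempty)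
  renaming (⊤ to full; ⊥ to ∅)
open import Data.Fin.Subset.Properties
  using ( _∈?_; _⊆?_; nonempty?; anySubset?; x∈p∩q⁺; x∈p∩q⁻; x∈p∪q⁺; x∈p∪q⁻; x∈⁅x⁆; x∈⁅y⁆⇒x≡y
        ; p─q⊆p; x∈p∧x∉q⇒x∈p─q; ∣p∣≤n; ∣⊤∣≡n; ∣⊥∣≡0; ∣⁅x⁆∣≡1; ∉⊥; p⊆q⇒∣p∣≤∣q∣; p∩q⊆p; p∩q⊆q)
open import Data.List using (List; []; _∷_)
open import Data.List.Relation.Unary.All as ListAll using ([]; _∷_)
import Data.List.Membership.DecPropositional
import Data.List.Membership.Propositional as List
open import Data.Nat
open import Data.Nat.Properties
open import Data.Nat.Tactic.RingSolver using (solve-∀)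
open import Data.Product using (Σ; ∃; _×_; _,_; proj₁; proj₂)
open import Data.Product.Properties using (≡-dec)
open import Data.Sum using (_⊎_; inj₁; inj₂; [_,_]′)
open import Data.Vec using (Vec; []; _∷_; lookup; tabulate; here; there)
open import Data.Vec.Properties using (lookup∘tabulate; []=⇒lookup; lookup⇒[]=)
open import Data.Vec.Relation.Unary.All using ([]; _∷_)
open import Data.Vec.Relation.Unary.AllPairs using ([]; _∷_)
open import Data.Vec.Relation.Unary.Unique.Propositional using (Unique)
open import Data.Vec.Relation.Unary.Unique.Propositional.Properties using (lookup-injective)
open import Function using (_∘_; const; case_of_)
open import Relation.Binary.PropositionalEquality
open import Relation.Nullary using (Dec; yes; no; does; ¬_; contradiction)
open import Relation.Nullary.Decidable using (_×-dec_; _⊎-dec_; _→-dec_; ¬?; dec-true; from-yes)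
open import Relation.Unary using (Decidable)

open Algebra.Properties.CommutativeMonoid.Sum +-0-commutativeMonoid using (sum; ∑-distrib-+; ∑-comm)

private
  variable
    m n : ℕ
    x : Fin n
    p q r : Subset n

-- Comprehensions and unions of finite sets

opaque
  ⟦_⟧ : {P : Fin n → Set} → Decidable P → Subset n
  ⟦ P? ⟧ = tabulate (does ∘ P?)

  ∈⟦⟧⁺ : {P : Fin n → Set} (P? : Decidable P) → P x → x ∈ ⟦ P? ⟧
  ∈⟦⟧⁺ {x = x} P? Px = lookup⇒[]= x _ (trans (lookup∘tabulate (does ∘ P?) x) (dec-true (P? x) Px))

  ∈⟦⟧⁻ : {P : Fin n → Set} (P? : Decidable P) → x ∈ ⟦ P? ⟧ → P x
  ∈⟦⟧⁻ {x = x} P? x∈ with P? x | trans (sym (lookup∘tabulate (does ∘ P?) x)) ([]=⇒lookup x∈)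
  ... | yes Px | _ = Px
  ... | no _   | ()

∈─⁻ : x ∈ p ─ q → x ∈ p × x ∉ q
∈─⁻ {p = p} {q} x∈ = p─q⊆p p q x∈ , x∉q p q x∈
  where
  x∉q : ∀ {n} {x : Fin n} (p q : Subset n) → x ∈ p ─ q → x ∉ q
  x∉q (_ ∷ p) (false ∷ q) (there x∈) (there x∈q) = x∉q p q x∈ x∈q
  x∉q (_ ∷ p) (true ∷ q)  (there x∈) (there x∈q) = x∉q p q x∈ x∈q

opaque
  ⋃[_]_ : Subset m → (Fin m → Subset n) → Subset n
  ⋃[ I ] A = ⟦ (λ x → Fin.any? λ i → (i ∈? I) ×-dec (x ∈? A i)) ⟧

  ∈⋃⁺ : {I : Subset m} (A : Fin m → Subset n) {i : Fin m} → i ∈ I → x ∈ A i → x ∈ ⋃[ I ] A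
  ∈⋃⁺ A {i} i∈ x∈ = ∈⟦⟧⁺ _ (i , i∈ , x∈)

  ∈⋃⁻ : {I : Subset m} (A : Fin m → Subset n) → x ∈ ⋃[ I ] A → ∃ λ i → i ∈ I × x ∈ A i
  ∈⋃⁻ A = ∈⟦⟧⁻ _

⋃-⁅⁆ : (A : Fin m → Subset n) (i : Fin m) → ⋃[ ⁅ i ⁆ ] A ⊆ A i
⋃-⁅⁆ A i x∈ with ∈⋃⁻ A x∈
... | j , j∈ , x∈A with refl ← x∈⁅y⁆⇒x≡y i j∈ = x∈A

-- Sums over finite sets

restrict : Bool → ℕ → ℕ
restrict true  a = a
restrict false a = 0

opaque
  -- Encoded as a sum over all indices with the terms outside `p` set to 0, so that sums over
  -- varying sets can be exchanged by `∑-comm`.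
  ∑ : Subset n → (Fin n → ℕ) → ℕ
  ∑ p f = sum λ i → restrict (lookup p i) (f i)

restrict-∈ : (p : Subset n) (a : ℕ) → x ∈ p → restrict (lookup p x) a ≡ a
restrict-∈ p a x∈ rewrite []=⇒lookup x∈ = refl

restrict-≤ : (p : Subset n) (x : Fin n) {a c : ℕ} → (x ∈ p → a ≤ c) → restrict (lookup p x) a ≤ c
restrict-≤ p x a≤c with lookup p x in eq
... | true  = a≤c (lookup⇒[]= x p eq)
... | false = z≤n

sum-mono-≤ : {f g : Fin n → ℕ} → (∀ i → f i ≤ g i) → sum f ≤ sum g
sum-mono-≤ {zero}  f≤g = z≤n
sum-mono-≤ {suc n} f≤g = +-mono-≤ (f≤g zero) (sum-mono-≤ (f≤g ∘ suc))

restrict-sum : (b : Bool) (f : Fin n → ℕ) → restrict b (sum f) ≡ sum (restrict b ∘ f)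
restrict-sum true  f = refl
restrict-sum {zero}  false f = refl
restrict-sum {suc n} false f = restrict-sum {n} false (f ∘ suc)

opaque
  unfolding ∑

  ∑-mono : (p : Subset n) {f g : Fin n → ℕ} → (∀ {i} → i ∈ p → f i ≤ g i) → ∑ p f ≤ ∑ p g
  ∑-mono p {g = g} f≤g = sum-mono-≤ λ i → restrict-≤ p i λ i∈ →
    ≤-trans (f≤g i∈) (≤-reflexive (sym (restrict-∈ p (g i) i∈)))

  ∑-⊆ : p ⊆ q → (f : Fin n → ℕ) → ∑ p f ≤ ∑ q f
  ∑-⊆ {p = p} {q} p⊆q f = sum-mono-≤ λ i → restrict-≤ p i λ i∈ →
    ≤-reflexive (sym (restrict-∈ q (f i) (p⊆q i∈)))

  ∑-const : (p : Subset n) (c : ℕ) → ∑ p (const c) ≡ ∣ p ∣ * c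
  ∑-const []          c = refl
  ∑-const (true  ∷ p) c = cong (c +_) (∑-const p c)
  ∑-const (false ∷ p) c = ∑-const p c

∑-≤-const : (p : Subset n) {f : Fin n → ℕ} {c : ℕ} → (∀ {i} → i ∈ p → f i ≤ c) → ∑ p f ≤ ∣ p ∣ * c
∑-≤-const p f≤c = ≤-trans (∑-mono p f≤c) (≤-reflexive (∑-const p _))

∑-≥-const : (p : Subset n) {f : Fin n → ℕ} {c : ℕ} → (∀ {i} → i ∈ p → c ≤ f i) → ∣ p ∣ * c ≤ ∑ p f
∑-≥-const p c≤f = ≤-trans (≤-reflexive (sym (∑-const p _))) (∑-mono p c≤f)

opaque
  unfolding ∑

  ∑-+ : (p : Subset n) (f g : Fin n → ℕ) → ∑ p (λ i → f i + g i) ≡ ∑ p f + ∑ p g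
  ∑-+ []          f g = refl
  ∑-+ (true  ∷ p) f g = trans (cong (f zero + g zero +_) (∑-+ p (f ∘ suc) (g ∘ suc)))
    (lemma (f zero) (g zero) _ _)
    where
    lemma : ∀ a b c d → (a + b) + (c + d) ≡ (a + c) + (b + d)
    lemma = solve-∀
  ∑-+ (false ∷ p) f g = ∑-+ p (f ∘ suc) (g ∘ suc)

  ∑-* : (p : Subset n) (c : ℕ) (f : Fin n → ℕ) → ∑ p (λ i → c * f i) ≡ c * ∑ p f
  ∑-* []          c f = sym (*-zeroʳ c)
  ∑-* (true  ∷ p) c f = trans (cong (c * f zero +_) (∑-* p c (f ∘ suc))) (sym (*-distribˡ-+ c (f zero) _))
  ∑-* (false ∷ p) c f = ∑-* p c (f ∘ suc)

∣∣≡∑ : (p : Subset n) → ∣ p ∣ ≡ ∑ p (const 1)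
∣∣≡∑ p = sym (trans (∑-const p 1) (*-identityʳ _))

opaque
  unfolding ∑

  -- Every pair counted on the left is also counted on the right. Only this inclusion is asked for,
  -- so `J` and `B` may be generous.
  double-count : (I : Subset m) (J : Subset n) (A : Fin m → Subset n) (B : Fin n → Subset m)
    (f : Fin m → Fin n → ℕ) → (∀ {i j} → i ∈ I → j ∈ A i → j ∈ J × i ∈ B j) →
    ∑ I (λ i → ∑ (A i) (f i)) ≤ ∑ J (λ j → ∑ (B j) (λ i → f i j))
  double-count I J A B f A⇒B = begin
    sum (λ i → restrict (lookup I i) (sum λ j → restrict (lookup (A i) j) (f i j)))
      ≤⟨ sum-mono-≤ (λ i → ≤-reflexive (restrict-sum (lookup I i) λ j → restrict (lookup (A i) j) (f i j))) ⟩
    sum (λ i → sum λ j → restrict (lookup I i) (restrict (lookup (A i) j) (f i j)))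
      ≡⟨ ∑-comm (λ i j → restrict (lookup I i) (restrict (lookup (A i) j) (f i j))) ⟩
    sum (λ j → sum λ i → restrict (lookup I i) (restrict (lookup (A i) j) (f i j)))
      ≤⟨ sum-mono-≤ (λ j → sum-mono-≤ λ i → termwise i j) ⟩
    sum (λ j → sum λ i → restrict (lookup J j) (restrict (lookup (B j) i) (f i j)))
      ≤⟨ sum-mono-≤ (λ j → ≤-reflexive (sym (restrict-sum (lookup J j) λ i → restrict (lookup (B j) i) (f i j)))) ⟩
    sum (λ j → restrict (lookup J j) (sum λ i → restrict (lookup (B j) i) (f i j))) ∎
    where
    open ≤-Reasoning
    termwise : ∀ i j → restrict (lookup I i) (restrict (lookup (A i) j) (f i j))
                     ≤ restrict (lookup J j) (restrict (lookup (B j) i) (f i j))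
    termwise i j = restrict-≤ I i λ i∈ → restrict-≤ (A i) j λ j∈ →
      let (j∈J , i∈B) = A⇒B i∈ j∈ in
      ≤-reflexive (sym (trans (restrict-∈ J _ j∈J) (restrict-∈ (B j) _ i∈B)))

double-count-∣∣ : (I : Subset m) (J : Subset n) (A : Fin m → Subset n) (B : Fin n → Subset m) →
  (∀ {i j} → i ∈ I → j ∈ A i → j ∈ J × i ∈ B j) → ∑ I (λ i → ∣ A i ∣) ≤ ∑ J (λ j → ∣ B j ∣)
double-count-∣∣ I J A B A⇒B = begin
  ∑ I (λ i → ∣ A i ∣)            ≤⟨ ∑-mono I (λ {i} _ → ≤-reflexive (∣∣≡∑ (A i))) ⟩
  ∑ I (λ i → ∑ (A i) (const 1))  ≤⟨ double-count I J A B (λ _ _ → 1) A⇒B ⟩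
  ∑ J (λ j → ∑ (B j) (const 1))  ≤⟨ ∑-mono J (λ {j} _ → ≤-reflexive (sym (∣∣≡∑ (B j)))) ⟩
  ∑ J (λ j → ∣ B j ∣)            ∎
  where
  open ≤-Reasoning

∣∣≤1 : (∀ {x y} → x ∈ p → y ∈ p → x ≡ y) → ∣ p ∣ ≤ 1
∣∣≤1 {p = p} unique with nonempty? p
... | yes (x , x∈) = subst (∣ p ∣ ≤_) (∣⁅x⁆∣≡1 x)
  (p⊆q⇒∣p∣≤∣q∣ λ y∈ → subst (_∈ ⁅ x ⁆) (unique x∈ y∈) (x∈⁅x⁆ x))
... | no empty = ≤-trans (≤-reflexive (∣∣≡∑ p)) (≤-trans
  (∑-≤-const p {c = 0} λ i∈ → contradiction (_ , i∈) empty)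
  (≤-trans (≤-reflexive (*-zeroʳ ∣ p ∣)) z≤n))

∈⇒1≤∣∣ : x ∈ p → 1 ≤ ∣ p ∣
∈⇒1≤∣∣ {x = x} {p} x∈ = subst (_≤ ∣ p ∣) (∣⁅x⁆∣≡1 x)
  (p⊆q⇒∣p∣≤∣q∣ λ y∈ → subst (_∈ p) (sym (x∈⁅y⁆⇒x≡y x y∈)) x∈)

1≤∣∣⇒nonempty : (p : Subset n) → 1 ≤ ∣ p ∣ → Nonempty p
1≤∣∣⇒nonempty p 1≤ with nonempty? p
... | yes ne = ne
... | no  empty = contradiction 1≤ (<⇒≱ (s≤s (≤-trans (≤-reflexive (∣∣≡∑ p)) (≤-trans
  (∑-≤-const p {c = 0} λ i∈ → contradiction (_ , i∈) empty) (≤-reflexive (*-zeroʳ ∣ p ∣))))))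

-- Each element of `p` lies in at least one `A i`; the incident pairs are then counted by `i`
-- instead.
∣⊆⋃∣≤ : (I : Subset m) (A : Fin m → Subset n) → p ⊆ ⋃[ I ] A → ∣ p ∣ ≤ ∑ I (λ i → ∣ A i ∣)
∣⊆⋃∣≤ {p = p} I A p⊆ = begin
  ∣ p ∣                ≡⟨ ∣∣≡∑ p ⟩
  ∑ p (const 1)        ≤⟨ ∑-mono p (λ x∈ → let (_ , i∈ , x∈A) = ∈⋃⁻ A (p⊆ x∈) in
                            ∈⇒1≤∣∣ (∈⟦⟧⁺ (covers _) (i∈ , x∈A))) ⟩
  ∑ p (λ x → ∣ ⟦ covers x ⟧ ∣)
                       ≤⟨ double-count-∣∣ p I _ A (λ {x} _ i∈ → ∈⟦⟧⁻ (covers x) i∈) ⟩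
  ∑ I (λ i → ∣ A i ∣)  ∎
  where
  open ≤-Reasoning
  covers : ∀ x → Decidable λ i → i ∈ I × x ∈ A i
  covers x i = (i ∈? I) ×-dec (x ∈? A i)

∣⋃∣≤ : (I : Subset m) (A : Fin m → Subset n) {c : ℕ} → (∀ {i} → i ∈ I → ∣ A i ∣ ≤ c) → ∣ ⋃[ I ] A ∣ ≤ ∣ I ∣ * c
∣⋃∣≤ I A ∣A∣≤ = ≤-trans (∣⊆⋃∣≤ I A λ x∈ → x∈) (∑-≤-const I ∣A∣≤)

∣∪∣≤ : (p q : Subset n) → ∣ p ∪ q ∣ ≤ ∣ p ∣ + ∣ q ∣
∣∪∣≤ []          []          = z≤n
∣∪∣≤ (true  ∷ p) (true  ∷ q) = s≤s (≤-trans (∣∪∣≤ p q) (+-monoʳ-≤ ∣ p ∣ (n≤1+n _)))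
∣∪∣≤ (true  ∷ p) (false ∷ q) = s≤s (∣∪∣≤ p q)
∣∪∣≤ (false ∷ p) (true  ∷ q) = ≤-trans (s≤s (∣∪∣≤ p q)) (≤-reflexive (sym (+-suc ∣ p ∣ ∣ q ∣)))
∣∪∣≤ (false ∷ p) (false ∷ q) = ∣∪∣≤ p q

∣⊆∪∣≤ : (q r : Subset n) → p ⊆ q ∪ r → ∣ p ∣ ≤ ∣ q ∣ + ∣ r ∣
∣⊆∪∣≤ q r p⊆ = ≤-trans (p⊆q⇒∣p∣≤∣q∣ p⊆) (∣∪∣≤ q r)

∣∣≤∣─∣+∣∣ : (p q : Subset n) → ∣ p ∣ ≤ ∣ p ─ q ∣ + ∣ q ∣
∣∣≤∣─∣+∣∣ p q = ∣⊆∪∣≤ (p ─ q) q λ {x} x∈ → x∈p∪q⁺ (split x∈ (x ∈? q))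
  where
  split : x ∈ p → Dec (x ∈ q) → x ∈ p ─ q ⊎ x ∈ q
  split x∈ (yes x∈q) = inj₂ x∈q
  split x∈ (no  x∉q) = inj₁ (x∈p∧x∉q⇒x∈p─q x∈ x∉q)

∣disjoint-∪∣ : (p q : Subset n) → (∀ {x} → x ∈ p → x ∉ q) → ∣ p ∣ + ∣ q ∣ ≤ ∣ p ∪ q ∣
∣disjoint-∪∣ []          []          disj = z≤n
∣disjoint-∪∣ (true  ∷ p) (true  ∷ q) disj = contradiction here (disj here)
∣disjoint-∪∣ (true  ∷ p) (false ∷ q) disj = s≤s (∣disjoint-∪∣ p q λ x∈ → disj (there x∈) ∘ there)
∣disjoint-∪∣ (false ∷ p) (true  ∷ q) disj = ≤-trans (≤-reflexive (+-suc ∣ p ∣ ∣ q ∣))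
  (s≤s (∣disjoint-∪∣ p q λ x∈ → disj (there x∈) ∘ there))
∣disjoint-∪∣ (false ∷ p) (false ∷ q) disj = ∣disjoint-∪∣ p q λ x∈ → disj (there x∈) ∘ there

average : (p : Subset n) (f : Fin n → ℕ) (c : ℕ) → Nonempty p → ∑ p f ≤ ∣ p ∣ * c → ∃ λ i → i ∈ p × f i ≤ c
average p f c (x , x∈) ∑≤ with Fin.any? (λ i → (i ∈? p) ×-dec (f i ≤? c))
... | yes found = found
... | no  none  = contradiction (≤-trans (∑-≥-const p λ {i} i∈ → ≰⇒> λ fi≤c → none (i , i∈ , fi≤c)) ∑≤)
  (<⇒≱ (*-monoʳ-< ∣ p ∣ {{>-nonZero (∈⇒1≤∣∣ x∈)}} (n<1+n c)))

-- Graphs in which every seven vertices contain an independent triple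

-- Every fibre of an injective map has at most one element. This turns seven distinct vertices into
-- a `Subset` of size 7.
∣image∣ : (f : Fin m → Fin n) → (∀ {i j} → f i ≡ f j → i ≡ j) → ∣ ⋃[ full ] (⁅_⁆ ∘ f) ∣ ≡ m
∣image∣ {m} f f-inj = ≤-antisym upper lower
  where
  open ≤-Reasoning
  image = ⋃[ full ] (⁅_⁆ ∘ f)
  fibre : ∀ x → Decidable λ i → f i ≡ x
  fibre x i = f i Fin.≟ x
  upper : ∣ image ∣ ≤ m
  upper = begin
    ∣ image ∣        ≤⟨ ∣⋃∣≤ full (⁅_⁆ ∘ f) (λ {i} _ → ≤-reflexive (∣⁅x⁆∣≡1 (f i))) ⟩
    ∣ full {m} ∣ * 1 ≡⟨ *-identityʳ _ ⟩
    ∣ full {m} ∣     ≡⟨ ∣⊤∣≡n m ⟩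
    m                ∎
  lower : m ≤ ∣ image ∣
  lower = begin
    m                                 ≡⟨ sym (*-identityʳ m) ⟩
    m * 1                             ≡⟨ cong (_* 1) (sym (∣⊤∣≡n m)) ⟩
    ∣ full {m} ∣ * 1                  ≤⟨ ∑-≥-const full (λ {i} _ → ≤-reflexive (sym (∣⁅x⁆∣≡1 (f i)))) ⟩
    ∑ full (λ i → ∣ ⁅ f i ⁆ ∣)        ≤⟨ double-count-∣∣ full image (⁅_⁆ ∘ f) (λ x → ⟦ fibre x ⟧)
                                          (λ {i} i∈ x∈ → ∈⋃⁺ (⁅_⁆ ∘ f) i∈ x∈ , ∈⟦⟧⁺ (fibre _) (sym (x∈⁅y⁆⇒x≡y (f i) x∈))) ⟩
    ∑ image (λ x → ∣ ⟦ fibre x ⟧ ∣)   ≤⟨ ∑-≤-const image (λ {x} _ → ∣∣≤1 λ i∈ j∈ →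
                                          f-inj (trans (∈⟦⟧⁻ (fibre x) i∈) (sym (∈⟦⟧⁻ (fibre x) j∈)))) ⟩
    ∣ image ∣ * 1                     ≡⟨ *-identityʳ _ ⟩
    ∣ image ∣                         ∎

-- Forbidden configurations on seven vertices

Pair : Set
Pair = Fin 7 × Fin 7

Joined : List Pair → Fin 7 → Fin 7 → Set
Joined E i j = (i , j) List.∈ E ⊎ (j , i) List.∈ E

joined? : ∀ E i j → Dec (Joined E i j)
joined? E i j = ((i , j) ∈ᴸ? E) ⊎-dec ((j , i) ∈ᴸ? E)
  where
  open Data.List.Membership.DecPropositional (≡-dec Fin._≟_ Fin._≟_) renaming (_∈?_ to _∈ᴸ?_)

NoIndependentTriple : List Pair → Set
NoIndependentTriple E = ∀ i j l → i ≡ j ⊎ i ≡ l ⊎ j ≡ l ⊎ Joined E i j ⊎ Joined E i l ⊎ Joined E j l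

-- For a concrete edge list the decision is made by evaluation over all triples.
noIndependentTriple? : Decidable NoIndependentTriple
noIndependentTriple? E = Fin.all? λ i → Fin.all? λ j → Fin.all? λ l →
  (i Fin.≟ j) ⊎-dec (i Fin.≟ l) ⊎-dec (j Fin.≟ l) ⊎-dec joined? E i j ⊎-dec joined? E i l ⊎-dec joined? E j l

K₄+K₃ spindle : List Pair
K₄+K₃ = (0F , 1F) ∷ (0F , 2F) ∷ (0F , 3F) ∷ (1F , 2F) ∷ (1F , 3F) ∷ (2F , 3F)
  ∷ (4F , 5F) ∷ (4F , 6F) ∷ (5F , 6F) ∷ []
-- The Moser spindle: diamonds 0-12-3 and 0-45-6 sharing the vertex 0, with 3 and 6 joined.
spindle = (0F , 1F) ∷ (0F , 2F) ∷ (1F , 2F) ∷ (1F , 3F) ∷ (2F , 3F)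
  ∷ (0F , 4F) ∷ (0F , 5F) ∷ (4F , 5F) ∷ (4F , 6F) ∷ (5F , 6F) ∷ (3F , 6F) ∷ []

≤∣─⁅⁆∣ : ∀ {k} (p : Subset n) x → suc k ≤ ∣ p ∣ → k ≤ ∣ p ─ ⁅ x ⁆ ∣
≤∣─⁅⁆∣ p x k< = ≤-pred (≤-trans k< (≤-trans (∣∣≤∣─∣+∣∣ p ⁅ x ⁆)
  (≤-reflexive (trans (cong (∣ p ─ ⁅ x ⁆ ∣ +_) (∣⁅x⁆∣≡1 x)) (+-comm _ 1)))))

three-elements : (p : Subset n) → 3 ≤ ∣ p ∣ →
  ∃ λ x → ∃ λ y → ∃ λ z → x ∈ p × y ∈ p × z ∈ p × x ≢ y × x ≢ z × y ≢ z
three-elements p 3≤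
  with x , x∈ ← 1≤∣∣⇒nonempty p (≤-trans (s≤s z≤n) 3≤)
  with 2≤ ← ≤∣─⁅⁆∣ p x 3≤
  with y , y∈ ← 1≤∣∣⇒nonempty (p ─ ⁅ x ⁆) (≤-trans (s≤s z≤n) 2≤)
  with z , z∈ ← 1≤∣∣⇒nonempty (p ─ ⁅ x ⁆ ─ ⁅ y ⁆) (≤∣─⁅⁆∣ (p ─ ⁅ x ⁆) y 2≤)
  with y∈p , y∉ ← ∈─⁻ y∈ | z∈′ , z∉y ← ∈─⁻ z∈
  with z∈p , z∉x ← ∈─⁻ z∈′
  = x , y , z , x∈ , y∈p , z∈p , (λ { refl → y∉ (x∈⁅x⁆ x) }) , (λ { refl → z∉x (x∈⁅x⁆ x) }) , (λ { refl → z∉y (x∈⁅x⁆ y) })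

-- Adjacency, independent sets and forbidden subgraphs

module Neighbourhoods (G : Graph n) where

  infix 4 _~_ _~?_

  _~_ : Fin n → Fin n → Set
  i ~ j = adj G i j ≡ true

  _~?_ : ∀ i j → Dec (i ~ j)
  i ~? j = adj G i j Bool.≟ true

  ~-sym : ∀ {i j} → i ~ j → j ~ i
  ~-sym {i} {j} i~j = trans (adj-sym G j i) i~j

  ~⇒≢ : ∀ {i j} → i ~ j → i ≢ j
  ~⇒≢ {i} i~i refl with () ← trans (sym i~i) (adj-irr G i)

  N : Fin n → Subset n
  N v = ⟦ (v ~?_) ⟧

  ∈N⁺ : ∀ {v x} → v ~ x → x ∈ N v
  ∈N⁺ = ∈⟦⟧⁺ _

  ∈N⁻ : ∀ {v x} → x ∈ N v → v ~ x
  ∈N⁻ = ∈⟦⟧⁻ _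

  independent⁺ : (∀ {i j} → i ∈ p → j ∈ p → ¬ i ~ j) → Independent G p
  independent⁺ ¬~ i j i∈ j∈ with adj G i j in eq
  ... | true  = contradiction eq (¬~ i∈ j∈)
  ... | false = refl

  independent⁻ : Independent G p → ∀ {i j} → i ∈ p → j ∈ p → ¬ i ~ j
  independent⁻ ind i∈ j∈ i~j with () ← trans (sym i~j) (ind _ _ i∈ j∈)

  independent-⊆ : p ⊆ q → Independent G q → Independent G p
  independent-⊆ p⊆q ind i j i∈ j∈ = ind i j (p⊆q i∈) (p⊆q j∈)

  independent? : Decidable (Independent G)
  independent? p = Fin.all? λ i → Fin.all? λ j →
    (i ∈? p) →-dec ((j ∈? p) →-dec (adj G i j Bool.≟ false))

  ∅-independent : Independent G ∅
  ∅-independent = independent⁺ λ i∈ _ → contradiction i∈ ∉⊥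

  α<⇒1≤ : ∀ {k} → (∀ I → Independent G I → ∣ I ∣ < k) → 1 ≤ k
  α<⇒1≤ α<k = ≤-trans (s≤s z≤n) (α<k ∅ ∅-independent)


  ⁅⁆-independent : ∀ v → Independent G ⁅ v ⁆
  ⁅⁆-independent v = independent⁺ λ i∈ j∈ i~j →
    ~⇒≢ i~j (trans (x∈⁅y⁆⇒x≡y v i∈) (sym (x∈⁅y⁆⇒x≡y v j∈)))

  K₄-free : Set
  K₄-free = ∀ {a b c d} → a ~ b → a ~ c → a ~ d → b ~ c → b ~ d → c ~ d → ⊥

  -- In a K₄-free graph these hypotheses force the seven vertices to be distinct.
  Spindle-free : Set
  Spindle-free = ∀ {v x y w x′ y′ w′} → v ~ x → v ~ y → x ~ y → x ~ w → y ~ w →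
    v ~ x′ → v ~ y′ → x′ ~ y′ → x′ ~ w′ → y′ ~ w′ → x ≢ x′ → x ≢ y′ → y ≢ x′ → y ≢ y′ → ¬ w ~ w′

  module _ (α₇≥3 : Alpha7≥3 G) where

    -- The hypothesis supplies an independent triple among the entries of `v`. Its indices are
    -- distinct, so by `E-triple` two of them are joined in `E`, and the corresponding vertices are
    -- adjacent.
    seven-vertices : ∀ E → NoIndependentTriple E → (v : Vec (Fin n) 7) → Unique v →
      ¬ ListAll.All (λ (i , j) → lookup v i ~ lookup v j) E
    seven-vertices E E-triple v v-unique edges =
      let (T , T⊆ , ∣T∣≡3 , T-ind) = α₇≥3 (⋃[ full ] (⁅_⁆ ∘ lookup v)) (∣image∣ (lookup v) λ {i} {j} → lookup-injective v-unique i j)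
          (x , y , z , x∈ , y∈ , z∈ , x≢y , x≢z , y≢z) = three-elements T (≤-reflexive (sym ∣T∣≡3))
          (i , vi≡x) = index (T⊆ x∈)
          (j , vj≡y) = index (T⊆ y∈)
          (l , vl≡z) = index (T⊆ z∈)
      in case E-triple i j l of λ where
          (inj₁ i≡j)                              → x≢y (trans (sym vi≡x) (trans (cong (lookup v) i≡j) vj≡y))
          (inj₂ (inj₁ i≡l))                       → x≢z (trans (sym vi≡x) (trans (cong (lookup v) i≡l) vl≡z))
          (inj₂ (inj₂ (inj₁ j≡l)))                → y≢z (trans (sym vj≡y) (trans (cong (lookup v) j≡l) vl≡z))
          (inj₂ (inj₂ (inj₂ (inj₁ ij))))          → independent⁻ T-ind x∈ y∈ (subst₂ _~_ vi≡x vj≡y (edge ij))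
          (inj₂ (inj₂ (inj₂ (inj₂ (inj₁ il)))))   → independent⁻ T-ind x∈ z∈ (subst₂ _~_ vi≡x vl≡z (edge il))
          (inj₂ (inj₂ (inj₂ (inj₂ (inj₂ jl)))))   → independent⁻ T-ind y∈ z∈ (subst₂ _~_ vj≡y vl≡z (edge jl))
      where
      edge : ∀ {i j} → Joined E i j → lookup v i ~ lookup v j
      edge (inj₁ ij∈) = ListAll.lookup edges ij∈
      edge (inj₂ ji∈) = ~-sym (ListAll.lookup edges ji∈)
      index : ∀ {x} → x ∈ ⋃[ full ] (⁅_⁆ ∘ lookup v) → ∃ λ i → lookup v i ≡ x
      index x∈ = let (i , _ , x∈vi) = ∈⋃⁻ (⁅_⁆ ∘ lookup v) x∈ in i , sym (x∈⁅y⁆⇒x≡y (lookup v i) x∈vi)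

    -- Two cliques cover the seven vertices, so no three of them are independent. Hence the graph
    -- outside a K₄ is triangle-free.
    no-K₄+K₃ : ∀ {a b c d x y z} → a ~ b → a ~ c → a ~ d → b ~ c → b ~ d → c ~ d →
      x ~ y → x ~ z → y ~ z →
      (∀ {u} → u ≡ x ⊎ u ≡ y ⊎ u ≡ z → u ≢ a × u ≢ b × u ≢ c × u ≢ d) → ⊥
    no-K₄+K₃ {a} {b} {c} {d} {x} {y} {z} ab ac ad bc bd cd xy xz yz disjoint
      with xa , xb , xc , xd ← disjoint (inj₁ refl)
      with ya , yb , yc , yd ← disjoint (inj₂ (inj₁ refl))
      with za , zb , zc , zd ← disjoint (inj₂ (inj₂ refl))
      = seven-vertices K₄+K₃ (from-yes (noIndependentTriple? K₄+K₃)) (a ∷ b ∷ c ∷ d ∷ x ∷ y ∷ z ∷ [])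
        ( (~⇒≢ ab ∷ ~⇒≢ ac ∷ ~⇒≢ ad ∷ ≢-sym xa ∷ ≢-sym ya ∷ ≢-sym za ∷ [])
        ∷ (~⇒≢ bc ∷ ~⇒≢ bd ∷ ≢-sym xb ∷ ≢-sym yb ∷ ≢-sym zb ∷ [])
        ∷ (~⇒≢ cd ∷ ≢-sym xc ∷ ≢-sym yc ∷ ≢-sym zc ∷ [])
        ∷ (≢-sym xd ∷ ≢-sym yd ∷ ≢-sym zd ∷ [])
        ∷ (~⇒≢ xy ∷ ~⇒≢ xz ∷ []) ∷ (~⇒≢ yz ∷ []) ∷ [] ∷ [])
        (ab ∷ ac ∷ ad ∷ bc ∷ bd ∷ cd ∷ xy ∷ xz ∷ yz ∷ [])

    spindle-free : K₄-free → Spindle-free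
    spindle-free K₄-free {v} {x} {y} {w} {x′} {y′} {w′} vx vy xy xw yw vx′ vy′ x′y′ x′w′ y′w′ xx′ xy′ yx′ yy′ ww′
      = seven-vertices spindle (from-yes (noIndependentTriple? spindle)) (v ∷ x ∷ y ∷ w ∷ x′ ∷ y′ ∷ w′ ∷ [])
        -- Apart from the adjacent pairs and the assumed inequalities, a coincidence would make `v`
        -- adjacent to `w` or `w′` and so complete a diamond to a K₄.
        ( (~⇒≢ vx ∷ ~⇒≢ vy ∷ (λ { refl → ¬vw′ ww′ }) ∷ ~⇒≢ vx′ ∷ ~⇒≢ vy′ ∷ (λ { refl → ¬vw (~-sym ww′) }) ∷ [])
        ∷ (~⇒≢ xy ∷ ~⇒≢ xw ∷ xx′ ∷ xy′ ∷ (λ { refl → ¬vw′ vx }) ∷ [])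
        ∷ (~⇒≢ yw ∷ yx′ ∷ yy′ ∷ (λ { refl → ¬vw′ vy }) ∷ [])
        ∷ ((λ { refl → ¬vw vx′ }) ∷ (λ { refl → ¬vw vy′ }) ∷ ~⇒≢ ww′ ∷ [])
        ∷ (~⇒≢ x′y′ ∷ ~⇒≢ x′w′ ∷ []) ∷ (~⇒≢ y′w′ ∷ []) ∷ [] ∷ [])
        (vx ∷ vy ∷ xy ∷ xw ∷ yw ∷ vx′ ∷ vy′ ∷ x′y′ ∷ x′w′ ∷ y′w′ ∷ ww′ ∷ [])
      where
      ¬vw : ¬ v ~ w
      ¬vw vw = K₄-free vx vy vw xy xw yw
      ¬vw′ : ¬ v ~ w′
      ¬vw′ vw′ = K₄-free vx′ vy′ vw′ x′y′ x′w′ y′w′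

  -- Expansion

  Expanding : Subset n → ℕ → Set
  Expanding V ρ = ∀ {I} → I ⊆ V → Independent G I → ρ * ∣ I ∣ ≤ ∣ ⋃[ I ] N ∩ V ∣

  -- Move non-expanding independent sets, together with their neighbourhoods, out of V for as
  -- long as there are any: their union stays independent, so this removes at most k (1 + ρ) vertices.
  expanding-subset : ∀ k → (∀ I → Independent G I → ∣ I ∣ < k) → ∀ V ρ →
    Σ (Subset n) λ V′ → V′ ⊆ V × ∣ V ∣ ≤ ∣ V′ ∣ + k * suc ρ × Expanding V′ ρ
  expanding-subset k α<k V ρ = go k ∅ V (λ x∈ → x∈) ∅-independent
    (λ i∈ _ → contradiction i∈ ∉⊥) (m≤m+n k _)
    (subst (λ z → ∣ V ∣ ≤ ∣ V ∣ + z * suc ρ) (sym (∣⊥∣≡0 n)) (m≤m+n ∣ V ∣ 0))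
    where
    open ≤-Reasoning
    go : ∀ fuel J V′ → V′ ⊆ V → Independent G J → (∀ {i x} → i ∈ J → x ∈ V′ → i ≢ x × ¬ i ~ x) →
      k ≤ fuel + ∣ J ∣ → ∣ V ∣ ≤ ∣ V′ ∣ + ∣ J ∣ * suc ρ →
      Σ (Subset n) λ V′ → V′ ⊆ V × ∣ V ∣ ≤ ∣ V′ ∣ + k * suc ρ × Expanding V′ ρ
    go fuel J V′ V′⊆V J-ind J∦V′ k≤ ∣V∣≤
      with anySubset? (λ I → (I ⊆? V′) ×-dec independent? I ×-dec (∣ ⋃[ I ] N ∩ V′ ∣ <? ρ * ∣ I ∣))
    ... | no none = V′ , V′⊆V , ≤-trans ∣V∣≤ (+-monoʳ-≤ ∣ V′ ∣ (*-monoˡ-≤ (suc ρ) (<⇒≤ (α<k J J-ind))))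
                  , λ {I} I⊆ I-ind → ≮⇒≥ λ small → none (I , I⊆ , I-ind , small)
    -- Once the fuel is used up, `J` would be an independent set of at least `k` vertices.
    go zero J V′ V′⊆V J-ind J∦V′ k≤ ∣V∣≤ | yes _ = contradiction k≤ (<⇒≱ (α<k J J-ind))
    go (suc fuel) J V′ V′⊆V J-ind J∦V′ k≤ ∣V∣≤ | yes (I , I⊆ , I-ind , small) =
      go fuel (J ∪ I) W (V′⊆V ∘ proj₁ ∘ ∈─⁻) J∪I-ind J∪I∦ k≤′ ∣V∣≤′
      where
      W = V′ ─ (I ∪ ⋃[ I ] N)
      1≤∣I∣ : 1 ≤ ∣ I ∣
      -- For empty `I`, `small` would ask for a cardinality below 0. Thus every round enlarges `J`.
      1≤∣I∣ = n≢0⇒n>0 λ ∣I∣≡0 → n≮0 (subst (∣ ⋃[ I ] N ∩ V′ ∣ <_) (trans (cong (ρ *_) ∣I∣≡0) (*-zeroʳ ρ)) small)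
      ∣J∪I∣≥ : ∣ J ∣ + ∣ I ∣ ≤ ∣ J ∪ I ∣
      ∣J∪I∣≥ = ∣disjoint-∪∣ J I λ x∈J x∈I → proj₁ (J∦V′ x∈J (I⊆ x∈I)) refl
      J∪I-ind : Independent G (J ∪ I)
      J∪I-ind = independent⁺ λ i∈ j∈ i~j → case (x∈p∪q⁻ J I i∈ , x∈p∪q⁻ J I j∈) of λ where
        (inj₁ i∈J , inj₁ j∈J) → independent⁻ J-ind i∈J j∈J i~j
        (inj₁ i∈J , inj₂ j∈I) → proj₂ (J∦V′ i∈J (I⊆ j∈I)) i~j
        (inj₂ i∈I , inj₁ j∈J) → proj₂ (J∦V′ j∈J (I⊆ i∈I)) (~-sym i~j)
        (inj₂ i∈I , inj₂ j∈I) → independent⁻ I-ind i∈I j∈I i~j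
      J∪I∦ : ∀ {i x} → i ∈ J ∪ I → x ∈ W → i ≢ x × ¬ i ~ x
      J∪I∦ i∈ x∈ with x∈V′ , x∉ ← ∈─⁻ x∈ | x∈p∪q⁻ J I i∈
      ... | inj₁ i∈J = J∦V′ i∈J x∈V′
      ... | inj₂ i∈I = (λ { refl → x∉ (x∈p∪q⁺ (inj₁ i∈I)) }) , λ i~x → x∉ (x∈p∪q⁺ (inj₂ (∈⋃⁺ N i∈I (∈N⁺ i~x))))
      k≤′ : k ≤ fuel + ∣ J ∪ I ∣
      k≤′ = begin
        k                       ≤⟨ k≤ ⟩
        suc (fuel + ∣ J ∣)      ≡⟨ sym (trans (cong (fuel +_) (+-comm _ 1)) (+-suc fuel ∣ J ∣)) ⟩
        fuel + (∣ J ∣ + 1)      ≤⟨ +-monoʳ-≤ fuel (≤-trans (+-monoʳ-≤ ∣ J ∣ 1≤∣I∣) ∣J∪I∣≥) ⟩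
        fuel + ∣ J ∪ I ∣        ∎
      removed : V′ ∩ (I ∪ ⋃[ I ] N) ⊆ I ∪ (⋃[ I ] N ∩ V′)
      removed x∈ with x∈V′ , x∈I∪ ← x∈p∩q⁻ V′ _ x∈ with x∈p∪q⁻ I _ x∈I∪
      ... | inj₁ x∈I = x∈p∪q⁺ (inj₁ x∈I)
      ... | inj₂ x∈N = x∈p∪q⁺ (inj₂ (x∈p∩q⁺ (x∈N , x∈V′)))
      ∣V∣≤′ : ∣ V ∣ ≤ ∣ W ∣ + ∣ J ∪ I ∣ * suc ρ
      ∣V∣≤′ = begin
        ∣ V ∣                                                        ≤⟨ ∣V∣≤ ⟩
        -- `V′` loses only `I` and the fewer than `ρ * ∣ I ∣` neighbours of `I` in it, a charge of
        -- at most `suc ρ` per vertex of `I`.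
        ∣ V′ ∣ + ∣ J ∣ * suc ρ                                       ≤⟨ +-monoˡ-≤ _ (∣⊆∪∣≤ W (I ∪ (⋃[ I ] N ∩ V′)) split) ⟩
        ∣ W ∣ + ∣ I ∪ (⋃[ I ] N ∩ V′) ∣ + ∣ J ∣ * suc ρ
          ≤⟨ +-monoˡ-≤ _ (+-monoʳ-≤ ∣ W ∣ (≤-trans (∣∪∣≤ I _) (+-monoʳ-≤ ∣ I ∣ (<⇒≤ small)))) ⟩
        ∣ W ∣ + (∣ I ∣ + ρ * ∣ I ∣) + ∣ J ∣ * suc ρ  ≡⟨ arith (∣ W ∣) (∣ I ∣) (∣ J ∣) ρ ⟩
        ∣ W ∣ + (∣ J ∣ + ∣ I ∣) * suc ρ            ≤⟨ +-monoʳ-≤ ∣ W ∣ (*-monoˡ-≤ (suc ρ) ∣J∪I∣≥) ⟩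
        ∣ W ∣ + ∣ J ∪ I ∣ * suc ρ                  ∎
        where
        arith : ∀ a i j ρ → a + (i + ρ * i) + j * suc ρ ≡ a + (j + i) * suc ρ
        arith = solve-∀
        split : V′ ⊆ W ∪ (I ∪ (⋃[ I ] N ∩ V′))
        split {x} x∈ with x ∈? (I ∪ ⋃[ I ] N)
        ... | yes x∈I∪ = x∈p∪q⁺ (inj₂ (removed (x∈p∩q⁺ (x∈ , x∈I∪))))
        ... | no  x∉I∪ = x∈p∪q⁺ (inj₁ (x∈p∧x∉q⇒x∈p─q x∈ x∉I∪))

-- Good pairs

module Links (G : Graph n) (K₄-free : Neighbourhoods.K₄-free G)
             (spindle-free : Neighbourhoods.Spindle-free G)
             (k : ℕ) (α<k : ∀ I → Independent G I → ∣ I ∣ < k) (S : Subset n) where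

  open Neighbourhoods G hiding (K₄-free; spindle-free)

  D : Fin n → Subset n
  D v = N v ∩ S

  ∈D⁺ : ∀ {v x} → v ~ x → x ∈ S → x ∈ D v
  ∈D⁺ v~x x∈S = x∈p∩q⁺ (∈N⁺ v~x , x∈S)

  ∈D⁻ : ∀ {v x} → x ∈ D v → v ~ x × x ∈ S
  ∈D⁻ {v} x∈ = let (x∈N , x∈S) = x∈p∩q⁻ (N v) S x∈ in ∈N⁻ x∈N , x∈S

  common : Fin n → Fin n → Subset n
  common v w = D v ∩ D w

  ∈common⁻ : ∀ {v w x} → x ∈ common v w → v ~ x × w ~ x × x ∈ S
  ∈common⁻ {v} {w} x∈ = let (x∈v , x∈w) = x∈p∩q⁻ (D v) (D w) x∈ in
    proj₁ (∈D⁻ x∈v) , proj₁ (∈D⁻ x∈w) , proj₂ (∈D⁻ x∈v)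

  ∈common⁺ : ∀ {v w x} → v ~ x → w ~ x → x ∈ S → x ∈ common v w
  ∈common⁺ v~x w~x x∈S = x∈p∩q⁺ (∈D⁺ v~x x∈S , ∈D⁺ w~x x∈S)

  1≤k : 1 ≤ k
  1≤k = α<⇒1≤ α<k

  -- Two adjacent common neighbours would complete the edge `v w` to a K₄.
  link-independent : ∀ {v w} → v ~ w → (∀ {x} → x ∈ p → v ~ x × w ~ x) → Independent G p
  link-independent v~w p⊆ = independent⁺ λ i∈ j∈ i~j →
    let (vi , wi) = p⊆ i∈ ; (vj , wj) = p⊆ j∈ in K₄-free v~w vi vj wi wj i~j

  -- Two vertices `a` and `b` are avoided because the middle edge of a diamond has two ends: a good
  -- pair has a diamond whose middle edge is disjoint from any prescribed one, as in the spindle.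
  Good : Fin n → Fin n → Set
  Good v w = ∀ a b → ∃ λ x → ∃ λ y → x ∈ common v w × y ∈ common v w × x ~ y
    × (x ≢ a × x ≢ b) × (y ≢ a × y ≢ b)

  avoiding? : ∀ v w a b → Dec (∃ λ x → ∃ λ y → x ∈ common v w × y ∈ common v w × x ~ y
    × (x ≢ a × x ≢ b) × (y ≢ a × y ≢ b))
  avoiding? v w a b = Fin.any? λ x → Fin.any? λ y →
    (x ∈? common v w) ×-dec (y ∈? common v w) ×-dec (x ~? y)
    ×-dec (¬? (x Fin.≟ a) ×-dec ¬? (x Fin.≟ b)) ×-dec (¬? (y Fin.≟ a) ×-dec ¬? (y Fin.≟ b))

  good? : ∀ v w → Dec (Good v w)
  good? v w = Fin.all? λ a → Fin.all? (avoiding? v w a)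

  Γ : Fin n → Subset n
  Γ v = ⟦ (λ w → (w ∈? S) ×-dec good? v w) ⟧

  ∈Γ⁻ : ∀ {v w} → w ∈ Γ v → w ∈ S × Good v w
  ∈Γ⁻ = ∈⟦⟧⁻ _

  ∉Γ⇒¬Good : ∀ {v w} → w ∈ S → w ∉ Γ v → ¬ Good v w
  ∉Γ⇒¬Good w∈S w∉ good = w∉ (∈⟦⟧⁺ _ (w∈S , good))

  -- Goodness gives a diamond from `v` to `w` whose middle edge is disjoint from that of the given
  -- diamond from `v` to `w′`; if `w` and `w′` were adjacent, this would be a spindle.
  good-nonadjacent : ∀ {v w x y w′} → Good v w → v ~ x → v ~ y → x ~ y → x ~ w′ → y ~ w′ → ¬ w ~ w′
  good-nonadjacent {x = x′} {y′} good vx′ vy′ x′y′ x′w′ y′w′ ww′ =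
    let (x , y , x∈ , y∈ , xy , (x≢x′ , x≢y′) , (y≢x′ , y≢y′)) = good x′ y′
        (vx , wx , _) = ∈common⁻ x∈
        (vy , wy , _) = ∈common⁻ y∈
    in spindle-free vx vy xy (~-sym wx) (~-sym wy) vx′ vy′ x′y′ x′w′ y′w′ x≢x′ x≢y′ y≢x′ y≢y′ ww′

  Γ-independent : ∀ v → Independent G (Γ v)
  Γ-independent v = independent⁺ λ {i} {j} i∈ j∈ →
    -- Any diamond from `v` to `j` will do, so the two vertices to avoid are arbitrary; goodness of
    -- `i` then moves the other diamond away from it.
    let (x , y , x∈ , y∈ , xy , _) = proj₂ (∈Γ⁻ j∈) v v
        (vx , jx , _) = ∈common⁻ x∈
        (vy , jy , _) = ∈common⁻ y∈
    in good-nonadjacent (proj₂ (∈Γ⁻ i∈)) vx vy xy (~-sym jx) (~-sym jy)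

  ∣Γ∣≤k : ∀ v → ∣ Γ v ∣ ≤ k
  ∣Γ∣≤k v = <⇒≤ (α<k (Γ v) (Γ-independent v))

  Covers : Fin n → Fin n → Subset n → Set
  Covers v w C = ∀ {x y} → x ∈ common v w → y ∈ common v w → x ~ y → x ∈ C ⊎ y ∈ C

  opaque
    -- Chosen for all pairs at once, with `∅` as the default for good pairs. For the others, `a` and
    -- `b` are read off from the failure of `Good`.
    cover : ∀ v w → Σ (Subset n) λ C → ∣ C ∣ ≤ 2 × (¬ Good v w → Covers v w C)
    cover v w with good? v w
    ... | yes good = ∅ , ≤-trans (≤-reflexive (∣⊥∣≡0 n)) z≤n , λ ¬good → contradiction good ¬good
    ... | no ¬good
      with a , ¬∃b ← Fin.¬∀⟶∃¬ n _ (λ a → Fin.all? (avoiding? v w a)) ¬good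
      with b , ¬∃ ← Fin.¬∀⟶∃¬ n _ (avoiding? v w a) ¬∃b
      = ⁅ a ⁆ ∪ ⁅ b ⁆
      , ≤-trans (∣∪∣≤ ⁅ a ⁆ ⁅ b ⁆) (≤-reflexive (cong₂ _+_ (∣⁅x⁆∣≡1 a) (∣⁅x⁆∣≡1 b)))
      , λ _ {x} {y} x∈ y∈ xy → covers x∈ y∈ xy (x ∈? ⁅ a ⁆ ∪ ⁅ b ⁆) (y ∈? ⁅ a ⁆ ∪ ⁅ b ⁆)
      where
      outside : ∀ {x} → x ∉ ⁅ a ⁆ ∪ ⁅ b ⁆ → x ≢ a × x ≢ b
      outside x∉ = (λ { refl → x∉ (x∈p∪q⁺ (inj₁ (x∈⁅x⁆ _))) }) , (λ { refl → x∉ (x∈p∪q⁺ (inj₂ (x∈⁅x⁆ _))) })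
      covers : ∀ {x y} → x ∈ common v w → y ∈ common v w → x ~ y →
        Dec (x ∈ ⁅ a ⁆ ∪ ⁅ b ⁆) → Dec (y ∈ ⁅ a ⁆ ∪ ⁅ b ⁆) → x ∈ ⁅ a ⁆ ∪ ⁅ b ⁆ ⊎ y ∈ ⁅ a ⁆ ∪ ⁅ b ⁆
      covers x∈ y∈ xy (yes x∈C) _         = inj₁ x∈C
      covers x∈ y∈ xy (no _)    (yes y∈C) = inj₂ y∈C
      covers x∈ y∈ xy (no x∉C)  (no y∉C)  = contradiction (_ , _ , x∈ , y∈ , xy , outside x∉C , outside y∉C) ¬∃

  -- Two vertices meet all edges of the common neighbourhood, so removing them leaves an independent
  -- set.
  ∣common∣≤ : ∀ {v w} → ¬ Good v w → ∣ common v w ∣ ≤ 2 * k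
  ∣common∣≤ {v} {w} ¬good = begin
    ∣ common v w ∣             ≤⟨ ∣∣≤∣─∣+∣∣ (common v w) C ⟩
    ∣ common v w ─ C ∣ + ∣ C ∣ ≤⟨ +-monoʳ-≤ ∣ common v w ─ C ∣ ∣C∣≤2 ⟩
    ∣ common v w ─ C ∣ + 2     ≡⟨ +-suc _ 1 ⟩
    -- Strictness of `α<k` absorbs one of the two removed vertices, `1≤k` the other.
    suc ∣ common v w ─ C ∣ + 1 ≤⟨ +-mono-≤ (α<k (common v w ─ C) rest-independent) 1≤k ⟩
    k + k                      ≡⟨ cong (k +_) (sym (+-identityʳ k)) ⟩
    2 * k                      ∎
    where
    open ≤-Reasoning
    C = proj₁ (cover v w)
    ∣C∣≤2 = proj₁ (proj₂ (cover v w))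
    rest-independent : Independent G (common v w ─ C)
    rest-independent = independent⁺ λ i∈ j∈ i~j →
      let (i∈vw , i∉C) = ∈─⁻ i∈ ; (j∈vw , j∉C) = ∈─⁻ j∈ in
      [ i∉C , j∉C ]′ (proj₂ (proj₂ (cover v w)) ¬good i∈vw j∈vw i~j)

  -- Flags: the vertices to be avoided in a neighbourhood

  -- Meant for edges `x y` of `D v`: it collects the `w` in `S` that form a triangle with `x y` but
  -- are not good for `v`.
  bad : Fin n → Fin n → Fin n → Subset n
  bad v x y = common x y ─ Γ v

  -- C is the vertex set of a maximal matching of edges x y of D v with more than r bad vertices.
  -- Together, the bad vertices of its edges form an independent set U, and since each w in U has
  -- a cover by two vertices, the sum Φ of the overlaps of these covers with C is at most 2k.
  module Flag (v : Fin n) (r : ℕ) where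

    cov : Fin n → Subset n
    cov w = proj₁ (cover v w)

    Φ : Subset n → Subset n → ℕ
    Φ U C = ∑ U λ w → ∣ cov w ∩ C ∣

    -- Remembers an edge inside `C` from which `w` came, to serve as the middle edge of one half of
    -- a spindle when an edge outside `C` supplies the other.
    Anchored : Subset n → Subset n → Set
    Anchored U C = ∀ {w} → w ∈ U → ∃ λ x → ∃ λ y → x ∈ C × y ∈ C × v ~ x × v ~ y × x ~ y × x ~ w × y ~ w

    Flags : Subset n → Set
    Flags C = ∀ {x y} → x ∈ D v → y ∈ D v → x ~ y → x ∉ C → y ∉ C → ∣ bad v x y ∣ ≤ r

    Φ≤ : ∀ U C → Independent G U → Φ U C ≤ 2 * k
    Φ≤ U C U-ind = begin
      Φ U C      ≤⟨ ∑-≤-const U (λ {w} _ → ≤-trans (p⊆q⇒∣p∣≤∣q∣ (p∩q⊆p (cov w) C)) (proj₁ (proj₂ (cover v w)))) ⟩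
      ∣ U ∣ * 2  ≤⟨ *-monoˡ-≤ 2 (<⇒≤ (α<k U U-ind)) ⟩
      k * 2      ≡⟨ *-comm k 2 ⟩
      2 * k      ∎
      where
      open ≤-Reasoning

    module Extend (C U : Subset n) (U-ind : Independent G U) (U-anch : Anchored U C)
                  {x y : Fin n} (x∈ : x ∈ D v) (y∈ : y ∈ D v) (xy : x ~ y) (x∉C : x ∉ C) (y∉C : y ∉ C) where

      vx : v ~ x
      vx = proj₁ (∈D⁻ x∈)

      vy : v ~ y
      vy = proj₁ (∈D⁻ y∈)

      W xy′ C′ U′ : Subset n
      W   = bad v x y
      xy′ = ⁅ x ⁆ ∪ ⁅ y ⁆
      C′  = C ∪ xy′
      U′  = U ∪ W

      ∈W⁻ : ∀ {w} → w ∈ W → x ~ w × y ~ w × w ∈ S × w ∉ Γ v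
      ∈W⁻ w∈ = let (w∈xy , w∉Γ) = ∈─⁻ w∈ ; (xw , yw , w∈S) = ∈common⁻ w∈xy in xw , yw , w∈S , w∉Γ

      x∈xy′ : x ∈ xy′
      x∈xy′ = x∈p∪q⁺ (inj₁ (x∈⁅x⁆ x))

      y∈xy′ : y ∈ xy′
      y∈xy′ = x∈p∪q⁺ (inj₂ (x∈⁅x⁆ y))

      C∦xy′ : ∀ {z} → z ∈ C → z ∉ xy′
      C∦xy′ z∈C z∈ with x∈p∪q⁻ ⁅ x ⁆ ⁅ y ⁆ z∈
      ... | inj₁ z∈x = x∉C (subst (_∈ C) (x∈⁅y⁆⇒x≡y x z∈x) z∈C)
      ... | inj₂ z∈y = y∉C (subst (_∈ C) (x∈⁅y⁆⇒x≡y y z∈y) z∈C)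

      ∉C⇒≢ : ∀ {z u} → z ∈ C → u ∉ C → z ≢ u
      ∉C⇒≢ z∈ u∉ refl = u∉ z∈

      C′⊆D : C ⊆ D v → C′ ⊆ D v
      C′⊆D C⊆ z∈ with x∈p∪q⁻ C xy′ z∈
      ... | inj₁ z∈C = C⊆ z∈C
      ... | inj₂ z∈xy with x∈p∪q⁻ ⁅ x ⁆ ⁅ y ⁆ z∈xy
      ...   | inj₁ z∈x = subst (_∈ D v) (sym (x∈⁅y⁆⇒x≡y x z∈x)) x∈
      ...   | inj₂ z∈y = subst (_∈ D v) (sym (x∈⁅y⁆⇒x≡y y z∈y)) y∈

      -- The edge `a b` anchoring `w` lies in `C` and is therefore disjoint from `x y`; adjacent `w`
      -- and `w′` would close a spindle at `v`.
      ¬U~W : ∀ {w w′} → w ∈ U → w′ ∈ W → ¬ w ~ w′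
      ¬U~W w∈ w′∈ ww′ =
        let (a , b , a∈ , b∈ , va , vb , ab , aw , bw) = U-anch w∈
            (xw′ , yw′ , _) = ∈W⁻ w′∈
        in spindle-free va vb ab aw bw vx vy xy xw′ yw′
             (∉C⇒≢ a∈ x∉C) (∉C⇒≢ a∈ y∉C) (∉C⇒≢ b∈ x∉C) (∉C⇒≢ b∈ y∉C) ww′

      U′-ind : Independent G U′
      U′-ind = independent⁺ λ i∈ j∈ i~j → case (x∈p∪q⁻ U W i∈ , x∈p∪q⁻ U W j∈) of λ where
        (inj₁ i∈U , inj₁ j∈U) → independent⁻ U-ind i∈U j∈U i~j
        (inj₁ i∈U , inj₂ j∈W) → ¬U~W i∈U j∈W i~j
        (inj₂ i∈W , inj₁ j∈U) → ¬U~W j∈U i∈W (~-sym i~j)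
        (inj₂ i∈W , inj₂ j∈W) → let (xi , yi , _) = ∈W⁻ i∈W ; (xj , yj , _) = ∈W⁻ j∈W in
                                K₄-free xy xi xj yi yj i~j

      U′-anch : Anchored U′ C′
      U′-anch w∈ with x∈p∪q⁻ U W w∈
      ... | inj₁ w∈U = let (a , b , a∈ , b∈ , rest) = U-anch w∈U in
                       a , b , x∈p∪q⁺ (inj₁ a∈) , x∈p∪q⁺ (inj₁ b∈) , rest
      ... | inj₂ w∈W = let (xw , yw , _) = ∈W⁻ w∈W in
                       x , y , x∈p∪q⁺ (inj₂ x∈xy′) , x∈p∪q⁺ (inj₂ y∈xy′) , vx , vy , xy , xw , yw

      -- The pair `v`, `w` is not good and `x y` is an edge of its common neighbourhood, so the
      -- cover contains `x` or `y`.
      cov-hits : ∀ {w} → w ∈ W → 1 ≤ ∣ cov w ∩ xy′ ∣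
      cov-hits {w} w∈ = let (xw , yw , w∈S , w∉Γ) = ∈W⁻ w∈ in
        [ (λ x∈cov → ∈⇒1≤∣∣ (x∈p∩q⁺ (x∈cov , x∈xy′))) , (λ y∈cov → ∈⇒1≤∣∣ (x∈p∩q⁺ (y∈cov , y∈xy′))) ]′
        (proj₂ (proj₂ (cover v w)) (∉Γ⇒¬Good w∈S w∉Γ)
          (∈common⁺ vx (~-sym xw) (proj₂ (∈D⁻ x∈))) (∈common⁺ vy (~-sym yw) (proj₂ (∈D⁻ y∈))) xy)

      -- As `xy′` is disjoint from `C`, the overlaps with the two sets add up, and every `w` in `W`
      -- gains at least 1, even if it was in `U` already.
      Φ-grows : Φ U C + ∣ W ∣ ≤ Φ U′ C′
      Φ-grows = begin
        Φ U C + ∣ W ∣                             ≤⟨ +-mono-≤ (∑-⊆ U⊆U′ _) W≤ ⟩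
        Φ U′ C + ∑ U′ (λ w → ∣ cov w ∩ xy′ ∣)     ≡⟨ sym (∑-+ U′ _ _) ⟩
        ∑ U′ (λ w → ∣ cov w ∩ C ∣ + ∣ cov w ∩ xy′ ∣)
          ≤⟨ ∑-mono U′ (λ {w} _ → ≤-trans
               (∣disjoint-∪∣ (cov w ∩ C) (cov w ∩ xy′) λ z∈ z∈′ → C∦xy′ (p∩q⊆q (cov w) C z∈) (p∩q⊆q (cov w) xy′ z∈′))
               (p⊆q⇒∣p∣≤∣q∣ λ z∈ → merge w (x∈p∪q⁻ (cov w ∩ C) (cov w ∩ xy′) z∈))) ⟩
        Φ U′ C′                                   ∎
        where
        open ≤-Reasoning
        U⊆U′ : U ⊆ U′
        U⊆U′ = x∈p∪q⁺ ∘ inj₁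
        W⊆U′ : W ⊆ U′
        W⊆U′ = x∈p∪q⁺ ∘ inj₂
        W≤ : ∣ W ∣ ≤ ∑ U′ (λ w → ∣ cov w ∩ xy′ ∣)
        W≤ = ≤-trans (≤-reflexive (sym (*-identityʳ ∣ W ∣)))
          (≤-trans (∑-≥-const W cov-hits) (∑-⊆ W⊆U′ _))
        merge : ∀ w {z} → z ∈ cov w ∩ C ⊎ z ∈ cov w ∩ xy′ → z ∈ cov w ∩ C′
        merge w (inj₁ z∈) = let (a , b) = x∈p∩q⁻ (cov w) C z∈ in x∈p∩q⁺ (a , x∈p∪q⁺ (inj₁ b))
        merge w (inj₂ z∈) = let (a , b) = x∈p∩q⁻ (cov w) xy′ z∈ in x∈p∩q⁺ (a , x∈p∪q⁺ (inj₂ b))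

      ∣xy′∣≤2 : ∣ xy′ ∣ ≤ 2
      ∣xy′∣≤2 = ≤-trans (∣∪∣≤ ⁅ x ⁆ ⁅ y ⁆) (≤-reflexive (cong₂ _+_ (∣⁅x⁆∣≡1 x) (∣⁅x⁆∣≡1 y)))

      -- One more edge adds at most two vertices to `C` and at least `r` to `Φ`, hence the factor 2.
      C′-bound : r ≤ ∣ W ∣ → r * ∣ C ∣ ≤ 2 * Φ U C → r * ∣ C′ ∣ ≤ 2 * Φ U′ C′
      C′-bound r≤ rC≤ = begin
        r * ∣ C′ ∣                 ≤⟨ *-monoʳ-≤ r (≤-trans (∣∪∣≤ C xy′) (+-monoʳ-≤ ∣ C ∣ ∣xy′∣≤2)) ⟩
        r * (∣ C ∣ + 2)            ≡⟨ trans (*-distribˡ-+ r _ 2) (cong (r * ∣ C ∣ +_) (*-comm r 2)) ⟩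
        r * ∣ C ∣ + 2 * r          ≤⟨ +-mono-≤ rC≤ (*-monoʳ-≤ 2 r≤) ⟩
        2 * Φ U C + 2 * ∣ W ∣      ≡⟨ sym (*-distribˡ-+ 2 (Φ U C) _) ⟩
        2 * (Φ U C + ∣ W ∣)        ≤⟨ *-monoʳ-≤ 2 Φ-grows ⟩
        2 * Φ U′ C′                ∎
        where
        open ≤-Reasoning

      ∣C′∣≥ : suc ∣ C ∣ ≤ ∣ C′ ∣
      ∣C′∣≥ = begin
        suc ∣ C ∣          ≡⟨ +-comm 1 ∣ C ∣ ⟩
        ∣ C ∣ + 1          ≤⟨ +-monoʳ-≤ ∣ C ∣ (∈⇒1≤∣∣ x∈xy′) ⟩
        ∣ C ∣ + ∣ xy′ ∣    ≤⟨ ∣disjoint-∪∣ C xy′ C∦xy′ ⟩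
        ∣ C′ ∣             ∎
        where
        open ≤-Reasoning

    opaque
      flags : Σ (Subset n) λ C → C ⊆ D v × r * ∣ C ∣ ≤ 4 * k × Flags C
      flags = go (suc n) ∅ ∅ (λ x∈ → contradiction x∈ ∉⊥) ∅-independent
        (λ w∈ → contradiction w∈ ∉⊥) (≤-trans (≤-reflexive (trans (cong (r *_) (∣⊥∣≡0 n)) (*-zeroʳ r))) z≤n) (m≤m+n (suc n) _)
        where
        open ≤-Reasoning
        flaggable? : ∀ C x y → Dec (x ∈ D v × y ∈ D v × x ~ y × x ∉ C × y ∉ C × r < ∣ bad v x y ∣)
        flaggable? C x y = (x ∈? D v) ×-dec (y ∈? D v) ×-dec (x ~? y) ×-dec ¬? (x ∈? C) ×-dec ¬? (y ∈? C)
          ×-dec (r <? ∣ bad v x y ∣)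
        go : ∀ fuel C U → C ⊆ D v → Independent G U → Anchored U C → r * ∣ C ∣ ≤ 2 * Φ U C → n < fuel + ∣ C ∣ →
          Σ (Subset n) λ C → C ⊆ D v × r * ∣ C ∣ ≤ 4 * k × Flags C
        go fuel C U C⊆ U-ind U-anch rC≤ n< with Fin.any? (λ x → Fin.any? (flaggable? C x))
        ... | no none = C , C⊆
          , ≤-trans rC≤ (≤-trans (*-monoʳ-≤ 2 (Φ≤ U C U-ind)) (≤-reflexive (sym (*-assoc 2 2 k))))
          , λ {x} {y} x∈ y∈ xy x∉ y∉ → ≮⇒≥ λ r< → none (x , y , x∈ , y∈ , xy , x∉ , y∉ , r<)
        -- `C` grows in every round and has at most `n` vertices, so the fuel `suc n` is enough.
        go zero C U C⊆ U-ind U-anch rC≤ n< | yes _ = contradiction n< (≤⇒≯ (∣p∣≤n C))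
        go (suc fuel) C U C⊆ U-ind U-anch rC≤ n< | yes (x , y , x∈ , y∈ , xy , x∉ , y∉ , r<) =
          go fuel E.C′ E.U′ (E.C′⊆D C⊆) E.U′-ind E.U′-anch (E.C′-bound (<⇒≤ r<) rC≤)
            (≤-trans n< (≤-trans (≤-reflexive (sym (+-suc fuel ∣ C ∣))) (+-monoʳ-≤ fuel E.∣C′∣≥)))
          where
          module E = Extend C U U-ind U-anch x∈ y∈ xy x∉ y∉

opaque
  -- Assigns each element of the union to a single member, which makes the members disjoint classes
  -- for counting. Outside the union, `f x` takes the dummy value `x`.
  ⋃-choice : (I : Subset n) (A : Fin n → Subset n) →
    ∃ λ (f : Fin n → Fin n) → ∀ {x} → x ∈ ⋃[ I ] A → f x ∈ I × x ∈ A (f x)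
  ⋃-choice {n} I A = f , f-spec
    where
    f : Fin n → Fin n
    f x with Fin.any? (λ i → (i ∈? I) ×-dec (x ∈? A i))
    ... | yes (i , _) = i
    ... | no  _       = x
    f-spec : ∀ {x} → x ∈ ⋃[ I ] A → f x ∈ I × x ∈ A (f x)
    f-spec {x} x∈ with Fin.any? (λ i → (i ∈? I) ×-dec (x ∈? A i))
    ... | yes (_ , i∈ , x∈A) = i∈ , x∈A
    ... | no  none           = contradiction (∈⋃⁻ A x∈) none

∑-⁅⁆ : (i : Fin n) (f : Fin n → ℕ) → ∑ ⁅ i ⁆ f ≤ f i
∑-⁅⁆ i f = ≤-trans (∑-≤-const ⁅ i ⁆ λ j∈ → ≤-reflexive (cong f (x∈⁅y⁆⇒x≡y i j∈)))
  (≤-reflexive (trans (cong (_* f i) (∣⁅x⁆∣≡1 i)) (*-identityˡ (f i))))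

-- Counting induced cherries of good pairs

module Cherries (G : Graph n) (K₄-free : Neighbourhoods.K₄-free G)
                (spindle-free : Neighbourhoods.Spindle-free G)
                (k : ℕ) (α<k : ∀ I → Independent G I → ∣ I ∣ < k) (S : Subset n)
                (r : ℕ) (1≤r : 1 ≤ r) (2k≤r³ : 2 * k ≤ r * (r * r)) where

  open Neighbourhoods G hiding (K₄-free; spindle-free)
  open Links G K₄-free spindle-free k α<k S

  instance
    r≢0 : NonZero r
    r≢0 = >-nonZero 1≤r

  C : Fin n → Subset n
  C v = proj₁ (Flag.flags v r)

  C⊆D : ∀ v → C v ⊆ D v
  C⊆D v = proj₁ (proj₂ (Flag.flags v r))

  heavy? : ∀ v → Decidable λ x → x ∈ D v × r < ∣ C v ∩ D x ∣
  heavy? v x = (x ∈? D v) ×-dec (r <? ∣ C v ∩ D x ∣)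

  -- The `x` in whose link steps from `v` are not controlled: `x` is flagged by `v`, or `x` has too
  -- many neighbours flagged by `v`.
  nonfine : Fin n → Subset n
  nonfine v = C v ∪ ⟦ heavy? v ⟧

  -- A flagged `y` is adjacent to `v`, so it has at most `k` common neighbours with `v`; counting
  -- pairs gives `r * ∣ heavy ∣ ≤ ∣ C v ∣ * k`. With `r * ∣ C v ∣ ≤ 4 * k` and both `r` and `k` at
  -- most r³, division by r² leaves 8kr.
  ∣nonfine∣≤ : ∀ v → ∣ nonfine v ∣ ≤ 8 * (k * r)
  ∣nonfine∣≤ v = *-cancelˡ-≤ r (*-cancelˡ-≤ r (begin
    r * (r * ∣ nonfine v ∣)              ≤⟨ *-monoʳ-≤ r (*-monoʳ-≤ r (∣∪∣≤ (C v) heavy)) ⟩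
    r * (r * (∣ C v ∣ + ∣ heavy ∣))      ≡⟨ cong (r *_) (*-distribˡ-+ r (∣ C v ∣) (∣ heavy ∣)) ⟩
    r * (r * ∣ C v ∣ + r * ∣ heavy ∣)    ≤⟨ *-monoʳ-≤ r (+-monoʳ-≤ (r * ∣ C v ∣) r∣heavy∣≤) ⟩
    r * (r * ∣ C v ∣ + ∣ C v ∣ * k)      ≡⟨ arith₁ r (∣ C v ∣) k ⟩
    (r * ∣ C v ∣) * (r + k)              ≤⟨ *-monoˡ-≤ (r + k) (proj₁ (proj₂ (proj₂ (Flag.flags v r)))) ⟩
    (4 * k) * (r + k)                    ≤⟨ *-monoʳ-≤ (4 * k) (+-mono-≤ r≤r³ (≤-trans (m≤m+n k _) 2k≤r³)) ⟩
    (4 * k) * (r * (r * r) + r * (r * r)) ≡⟨ arith₂ k r ⟩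
    r * (r * (8 * (k * r)))              ∎))
    where
    open ≤-Reasoning
    heavy = ⟦ heavy? v ⟧
    arith₁ : ∀ r c k → r * (r * c + c * k) ≡ (r * c) * (r + k)
    arith₁ = solve-∀
    arith₂ : ∀ k r → (4 * k) * (r * (r * r) + r * (r * r)) ≡ r * (r * (8 * (k * r)))
    arith₂ = solve-∀
    r≤r³ : r ≤ r * (r * r)
    r≤r³ = ≤-trans (m≤m*n r r) (*-monoʳ-≤ r (m≤m*n r r))
    r∣heavy∣≤ : r * ∣ heavy ∣ ≤ ∣ C v ∣ * k
    r∣heavy∣≤ = begin
      r * ∣ heavy ∣                     ≡⟨ *-comm r _ ⟩
      ∣ heavy ∣ * r                     ≤⟨ ∑-≥-const heavy (λ x∈ → <⇒≤ (proj₂ (∈⟦⟧⁻ (heavy? v) x∈))) ⟩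
      ∑ heavy (λ x → ∣ C v ∩ D x ∣)     ≤⟨ double-count-∣∣ heavy (C v) (λ x → C v ∩ D x) (common v) (λ {x} x∈ y∈ →
                                             let (y∈C , y∈Dx) = x∈p∩q⁻ (C v) (D x) y∈
                                                 (vx , x∈S) = ∈D⁻ (proj₁ (∈⟦⟧⁻ (heavy? v) x∈))
                                             in y∈C , ∈common⁺ vx (~-sym (proj₁ (∈D⁻ y∈Dx))) x∈S) ⟩
      ∑ (C v) (λ y → ∣ common v y ∣)    ≤⟨ ∑-≤-const (C v) (λ {y} y∈ → <⇒≤ (α<k (common v y)
                                             (link-independent (proj₁ (∈D⁻ (C⊆D v y∈)))
                                               λ z∈ → let (vz , yz , _) = ∈common⁻ z∈ in vz , yz))) ⟩
      ∣ C v ∣ * k                       ∎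

  excluded? : ∀ x → Decidable λ v → v ∈ S × x ∈ nonfine v
  excluded? x v = (v ∈? S) ×-dec (x ∈? nonfine v)

  -- The transpose of `nonfine`, which is bounded for each `v` and hence on average over `x`.
  excluded : Fin n → Subset n
  excluded x = ⟦ excluded? x ⟧

  ∑-excluded≤ : ∑ S (λ x → ∣ excluded x ∣) ≤ ∣ S ∣ * (8 * (k * r))
  ∑-excluded≤ = ≤-trans
    (double-count-∣∣ S S excluded nonfine λ {x} _ v∈ → ∈⟦⟧⁻ (excluded? x) v∈)
    (∑-≤-const S λ {v} _ → ∣nonfine∣≤ v)

  cherries : Fin n → ℕ
  cherries x = ∑ (D x) λ u₀ → ∑ (Γ u₀ ∩ D x) λ u → ∣ (Γ u ∩ D x) ─ Γ u₀ ∣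

  -- For fixed `u₀` there are at most `k` choices of `u` and then `k` of `y`; since `u₀` and `y` are
  -- not good, at most `2 * k` vertices `x` are adjacent to both.
  ∑-cherries≤ : ∑ S cherries ≤ ∣ S ∣ * (k * (k * (2 * k)))
  ∑-cherries≤ = begin
    ∑ S cherries
      ≤⟨ double-count S S D D (λ x u₀ → ∑ (Γ u₀ ∩ D x) λ u → ∣ (Γ u ∩ D x) ─ Γ u₀ ∣)
           (λ x∈ u₀∈ → let (xu₀ , u₀∈S) = ∈D⁻ u₀∈ in u₀∈S , ∈D⁺ (~-sym xu₀) x∈) ⟩
    ∑ S (λ u₀ → ∑ (D u₀) λ x → ∑ (Γ u₀ ∩ D x) λ u → ∣ (Γ u ∩ D x) ─ Γ u₀ ∣)
      ≤⟨ ∑-≤-const S (λ {u₀} u₀∈ → at u₀ u₀∈) ⟩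
    ∣ S ∣ * (k * (k * (2 * k))) ∎
    where
    open ≤-Reasoning
    at : ∀ u₀ → u₀ ∈ S → (∑ (D u₀) λ x → ∑ (Γ u₀ ∩ D x) λ u → ∣ (Γ u ∩ D x) ─ Γ u₀ ∣) ≤ k * (k * (2 * k))
    at u₀ u₀∈ = begin
      ∑ (D u₀) (λ x → ∑ (Γ u₀ ∩ D x) λ u → ∣ (Γ u ∩ D x) ─ Γ u₀ ∣)
        ≤⟨ double-count (D u₀) (Γ u₀) (λ x → Γ u₀ ∩ D x) (λ _ → D u₀) (λ x u → ∣ (Γ u ∩ D x) ─ Γ u₀ ∣)
             (λ {x} x∈ u∈ → proj₁ (x∈p∩q⁻ (Γ u₀) (D x) u∈) , x∈) ⟩
      ∑ (Γ u₀) (λ u → ∑ (D u₀) λ x → ∣ (Γ u ∩ D x) ─ Γ u₀ ∣)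
        ≤⟨ ∑-mono (Γ u₀) (λ {u} u∈ → double-count-∣∣ (D u₀) (Γ u ─ Γ u₀) (λ x → (Γ u ∩ D x) ─ Γ u₀) (common u₀)
             (λ {x} x∈ y∈ → let (y∈ux , y∉) = ∈─⁻ y∈ ; (y∈Γu , y∈Dx) = x∈p∩q⁻ (Γ u) (D x) y∈ux ; (u₀x , x∈S) = ∈D⁻ x∈ in
                x∈p∧x∉q⇒x∈p─q y∈Γu y∉ , ∈common⁺ u₀x (~-sym (proj₁ (∈D⁻ y∈Dx))) x∈S)) ⟩
      ∑ (Γ u₀) (λ u → ∑ (Γ u ─ Γ u₀) λ y → ∣ common u₀ y ∣)
        ≤⟨ ∑-mono (Γ u₀) (λ {u} _ → ∑-≤-const (Γ u ─ Γ u₀) λ y∈ → let (y∈Γu , y∉) = ∈─⁻ y∈ in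
             ∣common∣≤ (∉Γ⇒¬Good (proj₁ (∈Γ⁻ y∈Γu)) y∉)) ⟩
      ∑ (Γ u₀) (λ u → ∣ Γ u ─ Γ u₀ ∣ * (2 * k))
        ≤⟨ ∑-≤-const (Γ u₀) (λ {u} _ → *-monoˡ-≤ (2 * k) (≤-trans (p⊆q⇒∣p∣≤∣q∣ (p─q⊆p (Γ u) (Γ u₀))) (∣Γ∣≤k u))) ⟩
      ∣ Γ u₀ ∣ * (k * (2 * k))
        ≤⟨ *-monoˡ-≤ (k * (2 * k)) (∣Γ∣≤k u₀) ⟩
      k * (k * (2 * k)) ∎

  -- Good walks in the link of a vertex

  module Link (x : Fin n) (x∈S : x ∈ S) (L : Subset n) (L⊆ : L ⊆ D x) (L-fine : ∀ {v} → v ∈ L → x ∉ nonfine v)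
              (L-expanding : Expanding L (3 * r)) where

    -- Steps inside `L` that avoid the flags of their starting vertex. This orients the edges:
    -- `y ∈ O v` does not imply `v ∈ O y`.
    O : Fin n → Subset n
    O v = (N v ∩ L) ─ C v

    ∈O⁻ : ∀ {v y} → y ∈ O v → v ~ y × y ∈ L × y ∉ C v
    ∈O⁻ {v} y∈ = let (y∈NL , y∉C) = ∈─⁻ y∈ ; (y∈N , y∈L) = x∈p∩q⁻ (N v) L y∈NL in ∈N⁻ y∈N , y∈L , y∉C

    x~_ : ∀ {v} → v ∈ L → x ~ v
    x~_ v∈ = proj₁ (∈D⁻ (L⊆ v∈))

    O-independent : ∀ {v} → v ∈ L → p ⊆ O v → Independent G p
    O-independent v∈ p⊆ = link-independent (x~ v∈) λ y∈ →
      let (vy , y∈L , _) = ∈O⁻ (p⊆ y∈) in x~ y∈L , vy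

    x∈D_ : ∀ {v} → v ∈ L → x ∈ D v
    x∈D_ v∈ = ∈D⁺ (~-sym (x~ v∈)) x∈S

    x∉C_ : ∀ {v} → v ∈ L → x ∉ C v
    x∉C_ v∈ x∈C = L-fine v∈ (x∈p∪q⁺ (inj₁ x∈C))

    ∣C∩D∣≤ : ∀ {v} → v ∈ L → ∣ C v ∩ D x ∣ ≤ r
    ∣C∩D∣≤ {v} v∈ = ≮⇒≥ λ r< → L-fine v∈ (x∈p∪q⁺ (inj₂ (∈⟦⟧⁺ (heavy? v) (x∈D v∈ , r<))))

    -- By fineness each `i` flags at most `r` vertices of `D x`, so of the expansion `3 * r` at
    -- least `2 * r` survives.
    O-expanding : ∀ {I} → I ⊆ L → Independent G I → 2 * r * ∣ I ∣ ≤ ∣ ⋃[ I ] O ∣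
    O-expanding {I} I⊆ I-ind = +-cancelʳ-≤ (∣ I ∣ * r) _ _ (begin
      2 * r * ∣ I ∣ + ∣ I ∣ * r                          ≡⟨ arith r (∣ I ∣) ⟩
      3 * r * ∣ I ∣                                      ≤⟨ L-expanding I⊆ I-ind ⟩
      ∣ ⋃[ I ] N ∩ L ∣                                   ≤⟨ ∣⊆∪∣≤ (⋃[ I ] O) (⋃[ I ] λ i → C i ∩ D x) split ⟩
      ∣ ⋃[ I ] O ∣ + ∣ ⋃[ I ] (λ i → C i ∩ D x) ∣        ≤⟨ +-monoʳ-≤ (∣ ⋃[ I ] O ∣) (∣⋃∣≤ I _ λ i∈ → ∣C∩D∣≤ (I⊆ i∈)) ⟩
      ∣ ⋃[ I ] O ∣ + ∣ I ∣ * r                           ∎)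
      where
      open ≤-Reasoning
      arith : ∀ r i → 2 * r * i + i * r ≡ 3 * r * i
      arith = solve-∀
      split : ⋃[ I ] N ∩ L ⊆ ⋃[ I ] O ∪ ⋃[ I ] (λ i → C i ∩ D x)
      split {y} y∈ = let (y∈N , y∈L) = x∈p∩q⁻ (⋃[ I ] N) L y∈ ; (i , i∈ , y∈Ni) = ∈⋃⁻ N y∈N in
        case y ∈? C i of λ where
          (yes y∈C) → x∈p∪q⁺ (inj₂ (∈⋃⁺ _ i∈ (x∈p∩q⁺ (y∈C , L⊆ y∈L))))
          (no  y∉C) → x∈p∪q⁺ (inj₁ (∈⋃⁺ O i∈ (x∈p∧x∉q⇒x∈p─q (x∈p∩q⁺ (y∈Ni , y∈L)) y∉C)))

    -- A vertex `y` reached by the walk `f i`, `i`, `y` and not good for `f i` is in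
    -- `bad (f i) x i`. Neither end of the edge `x i` is flagged by `f i`, so at most `r` vertices
    -- are lost for each `i`.
    good-expanding : ∀ {I} → I ⊆ L → Independent G I → (f : Fin n → Fin n) →
      (∀ {i} → i ∈ I → f i ∈ L × i ∈ O (f i)) → r * ∣ I ∣ ≤ ∣ ⋃[ I ] (λ i → O i ∩ Γ (f i)) ∣
    good-expanding {I} I⊆ I-ind f f-spec = +-cancelʳ-≤ (∣ I ∣ * r) _ _ (begin
      r * ∣ I ∣ + ∣ I ∣ * r                                                       ≡⟨ arith r (∣ I ∣) ⟩
      2 * r * ∣ I ∣                                                               ≤⟨ O-expanding I⊆ I-ind ⟩
      ∣ ⋃[ I ] O ∣                                                                ≤⟨ ∣⊆∪∣≤ (⋃[ I ] λ i → O i ∩ Γ (f i)) (⋃[ I ] λ i → bad (f i) x i) split ⟩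
      ∣ ⋃[ I ] (λ i → O i ∩ Γ (f i)) ∣ + ∣ ⋃[ I ] (λ i → bad (f i) x i) ∣         ≤⟨ +-monoʳ-≤ (∣ ⋃[ I ] (λ i → O i ∩ Γ (f i)) ∣) (∣⋃∣≤ I _ few-bad) ⟩
      ∣ ⋃[ I ] (λ i → O i ∩ Γ (f i)) ∣ + ∣ I ∣ * r                                ∎)
      where
      open ≤-Reasoning
      arith : ∀ r i → r * i + i * r ≡ 2 * r * i
      arith = solve-∀
      few-bad : ∀ {i} → i ∈ I → ∣ bad (f i) x i ∣ ≤ r
      few-bad {i} i∈ = let (fi∈L , i∈O) = f-spec i∈ ; (fi~i , i∈L , i∉C) = ∈O⁻ i∈O in
        proj₂ (proj₂ (proj₂ (Flag.flags (f i) r))) (x∈D fi∈L) (∈D⁺ fi~i (proj₂ (∈D⁻ (L⊆ i∈L)))) (x~ i∈L) (x∉C fi∈L) i∉C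
      split : ⋃[ I ] O ⊆ ⋃[ I ] (λ i → O i ∩ Γ (f i)) ∪ ⋃[ I ] (λ i → bad (f i) x i)
      split {y} y∈ = let (i , i∈ , y∈O) = ∈⋃⁻ O y∈ ; (i~y , y∈L , _) = ∈O⁻ y∈O in
        case y ∈? Γ (f i) of λ where
          (yes y∈Γ) → x∈p∪q⁺ (inj₁ (∈⋃⁺ _ i∈ (x∈p∩q⁺ (y∈O , y∈Γ))))
          (no  y∉Γ) → x∈p∪q⁺ (inj₂ (∈⋃⁺ _ i∈ (x∈p∧x∉q⇒x∈p─q (∈common⁺ (x~ y∈L) i~y (proj₂ (∈D⁻ (L⊆ y∈L)))) y∉Γ)))

    -- Walks u₀ w u z y: the vertices u found beyond w are good for u₀, the vertices z beyond u for w, and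
    -- the vertices y beyond z for u. For each w this yields r² |U w| vertices y, at most k of
    -- which are good for u₀.
    module From (u₀ : Fin n) (u₀∈ : u₀ ∈ L) where

      W : Subset n
      W = O u₀

      W⊆L : W ⊆ L
      W⊆L w∈ = proj₁ (proj₂ (∈O⁻ w∈))

      second : Fin n → Subset n
      second w = O w ∩ Γ u₀

      via : Fin n → Fin n
      via = proj₁ (⋃-choice W second)

      U? : ∀ w → Decidable λ u → u ∈ ⋃[ W ] second × via u ≡ w
      U? w u = (u ∈? ⋃[ W ] second) ×-dec (via u Fin.≟ w)

      -- The classes of `via`: each `u` is charged to only one `w`, although several `w` may lead to
      -- it.
      U : Fin n → Subset n
      U w = ⟦ U? w ⟧

      U⊆O : ∀ {w} → U w ⊆ O w
      U⊆O {w} u∈ = let (u∈⋃ , via≡w) = ∈⟦⟧⁻ (U? w) u∈ in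
        subst (λ w → _ ∈ O w) via≡w (p∩q⊆p _ (Γ u₀) (proj₂ (proj₂ (⋃-choice W second) u∈⋃)))

      U⊆Γ : ∀ {w} → U w ⊆ Γ u₀
      U⊆Γ {w} u∈ = p∩q⊆q _ (Γ u₀) (proj₂ (proj₂ (⋃-choice W second) (proj₁ (∈⟦⟧⁻ (U? w) u∈))))

      U⊆L : ∀ {w} → U w ⊆ L
      U⊆L u∈ = proj₁ (proj₂ (∈O⁻ (U⊆O u∈)))

      new : Fin n → Subset n
      new u = (Γ u ∩ D x) ─ Γ u₀

      r∣W∣≤ : r * ∣ W ∣ ≤ ∑ W (λ w → ∣ U w ∣)
      r∣W∣≤ = ≤-trans
        (good-expanding W⊆L (O-independent u₀∈ λ w∈ → w∈) (const u₀) (λ w∈ → u₀∈ , w∈))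
        (∣⊆⋃∣≤ W U λ {u} u∈ → ∈⋃⁺ U (proj₁ (proj₂ (⋃-choice W second) u∈)) (∈⟦⟧⁺ (U? _) (u∈ , refl)))

      r²∣U∣≤ : ∀ {w} → w ∈ W → r * (r * ∣ U w ∣) ≤ k + ∑ (U w) (λ u → ∣ new u ∣)
      r²∣U∣≤ {w} w∈ = begin
        r * (r * ∣ U w ∣)                       ≤⟨ *-monoʳ-≤ r (good-expanding U⊆L U-ind (const w) (λ u∈ → W⊆L w∈ , U⊆O u∈)) ⟩
        -- Expansion applies again because `Z`, which need not lie in one neighbourhood within the
        -- link, lies in the independent set `Γ w`; this is why `z` was asked to be good for `w`.
        r * ∣ Z ∣                               ≤⟨ good-expanding Z⊆L Z-ind back (λ z∈ → U⊆L (back∈ z∈) , z∈O z∈) ⟩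
        -- Each `y` reached is good for `back z`, hence new for it unless it is also good for `u₀`.
        ∣ ⋃[ Z ] (λ z → O z ∩ Γ (back z)) ∣     ≤⟨ ∣⊆∪∣≤ (Γ u₀) (⋃[ U w ] new) split ⟩
        ∣ Γ u₀ ∣ + ∣ ⋃[ U w ] new ∣             ≤⟨ +-mono-≤ (∣Γ∣≤k u₀) (∣⊆⋃∣≤ (U w) new λ y∈ → y∈) ⟩
        k + ∑ (U w) (λ u → ∣ new u ∣)           ∎
        where
        open ≤-Reasoning
        U-ind : Independent G (U w)
        U-ind = O-independent (W⊆L w∈) U⊆O
        third : Fin n → Subset n
        third u = O u ∩ Γ w
        Z : Subset n
        Z = ⋃[ U w ] third
        back : Fin n → Fin n
        back = proj₁ (⋃-choice (U w) third)
        back∈ : ∀ {z} → z ∈ Z → back z ∈ U w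
        back∈ z∈ = proj₁ (proj₂ (⋃-choice (U w) third) z∈)
        z∈third : ∀ {z} → z ∈ Z → z ∈ third (back z)
        z∈third z∈ = proj₂ (proj₂ (⋃-choice (U w) third) z∈)
        z∈O : ∀ {z} → z ∈ Z → z ∈ O (back z)
        z∈O z∈ = p∩q⊆p (O _) (Γ w) (z∈third z∈)
        Z⊆L : Z ⊆ L
        Z⊆L z∈ = proj₁ (proj₂ (∈O⁻ (z∈O z∈)))
        Z-ind : Independent G Z
        Z-ind = independent-⊆ (λ z∈ → p∩q⊆q (O _) (Γ w) (z∈third z∈)) (Γ-independent w)
        split : ⋃[ Z ] (λ z → O z ∩ Γ (back z)) ⊆ Γ u₀ ∪ ⋃[ U w ] new
        split {y} y∈ = let (z , z∈ , y∈z) = ∈⋃⁻ _ y∈ ; (y∈O , y∈Γ) = x∈p∩q⁻ (O z) (Γ (back z)) y∈z in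
          case y ∈? Γ u₀ of λ where
            (yes y∈Γu₀) → x∈p∪q⁺ (inj₁ y∈Γu₀)
            (no  y∉Γu₀) → x∈p∪q⁺ (inj₂ (∈⋃⁺ new (back∈ z∈)
              (x∈p∧x∉q⇒x∈p─q (x∈p∩q⁺ (y∈Γ , L⊆ (proj₁ (proj₂ (∈O⁻ y∈O))))) y∉Γu₀)))

      ∑∑-new≤ : ∑ W (λ w → ∑ (U w) λ u → ∣ new u ∣) ≤ ∑ (Γ u₀ ∩ D x) (λ u → ∣ new u ∣)
      ∑∑-new≤ = ≤-trans
        (double-count W (Γ u₀ ∩ D x) U (λ u → ⁅ via u ⁆) (λ _ u → ∣ new u ∣) (λ {w} w∈ u∈ →
          x∈p∩q⁺ (U⊆Γ u∈ , L⊆ (U⊆L u∈)) ,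
          subst (_∈ ⁅ via _ ⁆) (proj₂ (∈⟦⟧⁻ (U? w) u∈)) (x∈⁅x⁆ _)))
        (∑-mono (Γ u₀ ∩ D x) λ {u} _ → ∑-⁅⁆ (via u) (λ _ → ∣ new u ∣))

      2r≤∣W∣ : 2 * r ≤ ∣ W ∣
      2r≤∣W∣ = begin
        2 * r                  ≡⟨ sym (*-identityʳ (2 * r)) ⟩
        2 * r * 1              ≡⟨ cong (2 * r *_) (sym (∣⁅x⁆∣≡1 u₀)) ⟩
        2 * r * ∣ ⁅ u₀ ⁆ ∣     ≤⟨ O-expanding (λ v∈ → subst (_∈ L) (sym (x∈⁅y⁆⇒x≡y u₀ v∈)) u₀∈) (⁅⁆-independent u₀) ⟩
        ∣ ⋃[ ⁅ u₀ ⁆ ] O ∣      ≤⟨ p⊆q⇒∣p∣≤∣q∣ (⋃-⁅⁆ O u₀) ⟩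
        ∣ W ∣                  ∎
        where
        open ≤-Reasoning

      -- `main` and `2k≤r³` give `r³ ∣ W ∣ ≤ 2 T`, and `W` has at least `2 * r` vertices.
      r⁴≤ : r * (r * (r * r)) ≤ ∑ (Γ u₀ ∩ D x) (λ u → ∣ new u ∣)
      r⁴≤ = *-cancelˡ-≤ 2 (+-cancelˡ-≤ (r * (r * (r * ∣ W ∣))) _ _ (begin
        r * (r * (r * ∣ W ∣)) + 2 * (r * (r * (r * r)))          ≡⟨ cong (r * (r * (r * ∣ W ∣)) +_) (arith₁ r) ⟩
        r * (r * (r * ∣ W ∣)) + r * (r * (r * (2 * r)))          ≤⟨ +-monoʳ-≤ (r * (r * (r * ∣ W ∣))) (*-monoʳ-≤ r (*-monoʳ-≤ r (*-monoʳ-≤ r 2r≤∣W∣))) ⟩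
        r * (r * (r * ∣ W ∣)) + r * (r * (r * ∣ W ∣))            ≡⟨ arith₂ (r * (r * (r * ∣ W ∣))) ⟩
        2 * (r * (r * (r * ∣ W ∣)))                              ≤⟨ *-monoʳ-≤ 2 main ⟩
        2 * (∣ W ∣ * k + T)                                      ≡⟨ arith₃ (∣ W ∣) k T ⟩
        2 * k * ∣ W ∣ + 2 * T                                    ≤⟨ +-monoˡ-≤ (2 * T) (*-monoˡ-≤ (∣ W ∣) 2k≤r³) ⟩
        r * (r * r) * ∣ W ∣ + 2 * T                              ≡⟨ cong (_+ 2 * T) (arith₄ r (∣ W ∣)) ⟩
        r * (r * (r * ∣ W ∣)) + 2 * T                            ∎))
        where
        open ≤-Reasoning
        T = ∑ (Γ u₀ ∩ D x) (λ u → ∣ new u ∣)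
        arith₁ : ∀ r → 2 * (r * (r * (r * r))) ≡ r * (r * (r * (2 * r)))
        arith₁ = solve-∀
        arith₂ : ∀ a → a + a ≡ 2 * a
        arith₂ = solve-∀
        arith₃ : ∀ w k t → 2 * (w * k + t) ≡ 2 * k * w + 2 * t
        arith₃ = solve-∀
        arith₄ : ∀ r w → r * (r * r) * w ≡ r * (r * (r * w))
        arith₄ = solve-∀
        main : r * (r * (r * ∣ W ∣)) ≤ ∣ W ∣ * k + T
        main = begin
          r * (r * (r * ∣ W ∣))                              ≤⟨ *-monoʳ-≤ r (*-monoʳ-≤ r r∣W∣≤) ⟩
          r * (r * ∑ W (λ w → ∣ U w ∣))                      ≡⟨ cong (r *_) (sym (∑-* W r _)) ⟩
          r * ∑ W (λ w → r * ∣ U w ∣)                        ≡⟨ sym (∑-* W r _) ⟩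
          ∑ W (λ w → r * (r * ∣ U w ∣))                      ≤⟨ ∑-mono W r²∣U∣≤ ⟩
          ∑ W (λ w → k + ∑ (U w) λ u → ∣ new u ∣)            ≡⟨ ∑-+ W _ _ ⟩
          ∑ W (const k) + ∑ W (λ w → ∑ (U w) λ u → ∣ new u ∣) ≤⟨ +-mono-≤ (≤-reflexive (∑-const W k)) ∑∑-new≤ ⟩
          ∣ W ∣ * k + T                                      ∎

    ∣L∣r⁴≤cherries : ∣ L ∣ * (r * (r * (r * r))) ≤ cherries x
    ∣L∣r⁴≤cherries = ≤-trans (∑-≥-const L λ {u₀} u₀∈ → From.r⁴≤ u₀ u₀∈) (∑-⊆ L⊆ _)

-- The combination `b * f i + a * g i` weights both bounds equally: its average is at most
-- `2 * (a * b)`, and each summand is below the total.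
average₂ : (p : Subset n) (f g : Fin n → ℕ) (a b : ℕ) → 1 ≤ b → Nonempty p → 1 ≤ a →
  ∑ p f ≤ ∣ p ∣ * a → ∑ p g ≤ ∣ p ∣ * b → ∃ λ i → i ∈ p × f i ≤ 2 * a × g i ≤ 2 * b
average₂ p f g a b 1≤b ne 1≤a ∑f≤ ∑g≤ =
  let (i , i∈ , h≤) = average p (λ i → b * f i + a * g i) (2 * (a * b)) ne ∑h≤ in
  i , i∈ , *-cancelˡ-≤ b {{>-nonZero 1≤b}} (≤-trans (≤-trans (m≤m+n _ _) h≤) (≤-reflexive (arith₂ a b)))
         , *-cancelˡ-≤ a {{>-nonZero 1≤a}} (≤-trans (≤-trans (m≤n+m _ _) h≤) (≤-reflexive (arith₃ a b)))
  where
  open ≤-Reasoning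
  arith₁ : ∀ p a b → b * (p * a) + a * (p * b) ≡ p * (2 * (a * b))
  arith₁ = solve-∀
  arith₂ : ∀ a b → 2 * (a * b) ≡ b * (2 * a)
  arith₂ = solve-∀
  arith₃ : ∀ a b → 2 * (a * b) ≡ a * (2 * b)
  arith₃ = solve-∀
  ∑h≤ : ∑ p (λ i → b * f i + a * g i) ≤ ∣ p ∣ * (2 * (a * b))
  ∑h≤ = begin
    ∑ p (λ i → b * f i + a * g i)             ≡⟨ ∑-+ p _ _ ⟩
    ∑ p (λ i → b * f i) + ∑ p (λ i → a * g i) ≡⟨ cong₂ _+_ (∑-* p b f) (∑-* p a g) ⟩
    b * ∑ p f + a * ∑ p g                     ≤⟨ +-mono-≤ (*-monoʳ-≤ b ∑f≤) (*-monoʳ-≤ a ∑g≤) ⟩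
    b * (∣ p ∣ * a) + a * (∣ p ∣ * b)         ≡⟨ arith₁ (∣ p ∣) a b ⟩
    ∣ p ∣ * (2 * (a * b))                     ∎

-- The bound on the order of the graph

fifth-power : ∀ r → r ^ 5 ≡ r * (r * (r * (r * r)))
fifth-power r = cong (λ z → r * (r * (r * (r * z)))) (*-identityʳ r)

module OrderBound (G : Graph n) (α₇≥3 : Alpha7≥3 G)
                  (k : ℕ) (α<k : ∀ I → Independent G I → ∣ I ∣ < k)
                  (r : ℕ) (1≤r : 1 ≤ r) (8k²≤r⁵ : 8 * (k * k) ≤ r ^ 5) where

  open Neighbourhoods G

  1≤k : 1 ≤ k
  1≤k = α<⇒1≤ α<k

  instance
    r≢0 : NonZero r
    r≢0 = >-nonZero 1≤r
    k≢0 : NonZero k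
    k≢0 = >-nonZero 1≤k
    kr≢0 : NonZero (k * r)
    kr≢0 = m*n≢0 k r

  -- Otherwise r⁶ < 4k² ≤ 8k² ≤ r⁵ ≤ r⁶.
  2k≤r³ : 2 * k ≤ r * (r * r)
  2k≤r³ = ≮⇒≥ λ r³<2k → <⇒≱ (*-mono-< r³<2k r³<2k) (begin
    2 * k * (2 * k)                   ≤⟨ m≤m+n _ _ ⟩
    2 * k * (2 * k) + 4 * (k * k)     ≡⟨ arith₁ k ⟩
    8 * (k * k)                       ≤⟨ 8k²≤r⁵ ⟩
    r ^ 5                             ≡⟨ fifth-power r ⟩
    r * (r * (r * (r * r)))           ≤⟨ m≤n*m _ r ⟩
    r * (r * (r * (r * (r * r))))     ≡⟨ arith₂ r ⟩
    r * (r * r) * (r * (r * r))       ∎)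
    where
    open ≤-Reasoning
    arith₁ : ∀ k → 2 * k * (2 * k) + 4 * (k * k) ≡ 8 * (k * k)
    arith₁ = solve-∀
    arith₂ : ∀ r → r * (r * (r * (r * (r * r)))) ≡ r * (r * r) * (r * (r * r))
    arith₂ = solve-∀

  degree≥ : ∀ {V ρ} → Expanding V ρ → ∀ {v} → v ∈ V → ρ ≤ ∣ N v ∩ V ∣
  degree≥ {V} {ρ} V-exp {v} v∈ = begin
    ρ                          ≡⟨ sym (*-identityʳ ρ) ⟩
    ρ * 1                      ≡⟨ cong (ρ *_) (sym (∣⁅x⁆∣≡1 v)) ⟩
    ρ * ∣ ⁅ v ⁆ ∣              ≤⟨ V-exp (λ x∈ → subst (_∈ V) (sym (x∈⁅y⁆⇒x≡y v x∈)) v∈) (⁅⁆-independent v) ⟩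
    ∣ ⋃[ ⁅ v ⁆ ] N ∩ V ∣       ≤⟨ p⊆q⇒∣p∣≤∣q∣ (λ x∈ → let (x∈⋃ , x∈V) = x∈p∩q⁻ (⋃[ ⁅ v ⁆ ] N) V x∈ in
                                    x∈p∩q⁺ (⋃-⁅⁆ N v x∈⋃ , x∈V)) ⟩
    ∣ N v ∩ V ∣                ∎
    where
    open ≤-Reasoning

  empty-bound : ∀ {ρ} (V : Subset n) → ¬ Nonempty V → ∀ {a} → a ≤ ∣ V ∣ + k * suc ρ → a ≤ k * suc ρ
  empty-bound V empty a≤ = ≤-trans a≤ (+-monoˡ-≤ _ (≤-pred (≰⇒> λ 1≤ → empty (1≤∣∣⇒nonempty V 1≤))))

  -- Outside the K₄ neighbourhoods are independent, so degrees are below `k`, while a nonempty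
  -- `k`-expanding subset would have degrees at least `k`. Hence that subset is empty.
  K₄-bound : ∀ {a b c d} → a ~ b → a ~ c → a ~ d → b ~ c → b ~ d → c ~ d → n ≤ 22 * (k * (k * r))
  K₄-bound {a} {b} {c} {d} ab ac ad bc bd cd =
    let (V′ , V′⊆ , ∣V∣≤ , V′-exp) = expanding-subset k α<k V k in bound V′ V′⊆ ∣V∣≤ V′-exp
    where
    open ≤-Reasoning
    Q V : Subset n
    Q = ⁅ a ⁆ ∪ ⁅ b ⁆ ∪ ⁅ c ⁆ ∪ ⁅ d ⁆
    V = full ─ Q
    ∣Q∣≤4 : ∣ Q ∣ ≤ 4
    ∣Q∣≤4 = begin
      ∣ Q ∣                                          ≤⟨ ∣∪∣≤ ⁅ a ⁆ _ ⟩
      ∣ ⁅ a ⁆ ∣ + ∣ ⁅ b ⁆ ∪ ⁅ c ⁆ ∪ ⁅ d ⁆ ∣         ≤⟨ +-mono-≤ (≤-reflexive (∣⁅x⁆∣≡1 a)) (∣∪∣≤ ⁅ b ⁆ _) ⟩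
      1 + (∣ ⁅ b ⁆ ∣ + ∣ ⁅ c ⁆ ∪ ⁅ d ⁆ ∣)           ≤⟨ +-monoʳ-≤ 1 (+-mono-≤ (≤-reflexive (∣⁅x⁆∣≡1 b)) (∣∪∣≤ ⁅ c ⁆ _)) ⟩
      1 + (1 + (∣ ⁅ c ⁆ ∣ + ∣ ⁅ d ⁆ ∣))             ≡⟨ cong (2 +_) (cong₂ _+_ (∣⁅x⁆∣≡1 c) (∣⁅x⁆∣≡1 d)) ⟩
      4                                              ∎
    outside : ∀ {u} → u ∈ V → u ≢ a × u ≢ b × u ≢ c × u ≢ d
    outside u∈ = let u∉ = proj₂ (∈─⁻ u∈) in
      (λ { refl → u∉ (x∈p∪q⁺ (inj₁ (x∈⁅x⁆ a))) }) ,
      (λ { refl → u∉ (x∈p∪q⁺ (inj₂ (x∈p∪q⁺ (inj₁ (x∈⁅x⁆ b))))) }) ,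
      (λ { refl → u∉ (x∈p∪q⁺ (inj₂ (x∈p∪q⁺ (inj₂ (x∈p∪q⁺ (inj₁ (x∈⁅x⁆ c))))))) }) ,
      (λ { refl → u∉ (x∈p∪q⁺ (inj₂ (x∈p∪q⁺ (inj₂ (x∈p∪q⁺ (inj₂ (x∈⁅x⁆ d))))))) })
    triangle-free : ∀ {x y z} → x ∈ V → y ∈ V → z ∈ V → x ~ y → x ~ z → ¬ y ~ z
    triangle-free x∈ y∈ z∈ xy xz yz = no-K₄+K₃ α₇≥3 ab ac ad bc bd cd xy xz yz λ where
      (inj₁ refl)        → outside x∈
      (inj₂ (inj₁ refl)) → outside y∈
      (inj₂ (inj₂ refl)) → outside z∈
    n≤ : n ≤ ∣ V ∣ + 4
    n≤ = begin
      n               ≡⟨ sym (∣⊤∣≡n n) ⟩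
      ∣ full {n} ∣    ≤⟨ ∣∣≤∣─∣+∣∣ full Q ⟩
      ∣ V ∣ + ∣ Q ∣   ≤⟨ +-monoʳ-≤ (∣ V ∣) ∣Q∣≤4 ⟩
      ∣ V ∣ + 4       ∎
    k≤k² : k ≤ k * k
    k≤k² = m≤m*n k k
    bound : ∀ V′ → V′ ⊆ V → ∣ V ∣ ≤ ∣ V′ ∣ + k * suc k → Expanding V′ k → n ≤ 22 * (k * (k * r))
    bound V′ V′⊆ ∣V∣≤ V′-exp with nonempty? V′
    ... | yes (v , v∈) = contradiction (degree≥ V′-exp v∈) (<⇒≱ (α<k (N v ∩ V′) (independent⁺ λ i∈ j∈ →
            let (vi , i∈V′) = x∈p∩q⁻ (N v) V′ i∈ ; (vj , j∈V′) = x∈p∩q⁻ (N v) V′ j∈ in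
            triangle-free (V′⊆ v∈) (V′⊆ i∈V′) (V′⊆ j∈V′) (∈N⁻ vi) (∈N⁻ vj))))
    ... | no  empty    = begin
      n                                    ≤⟨ n≤ ⟩
      ∣ V ∣ + 4                            ≤⟨ +-mono-≤ (empty-bound V′ empty ∣V∣≤) (*-monoʳ-≤ 4 (≤-trans 1≤k k≤k²)) ⟩
      k * suc k + 4 * (k * k)              ≡⟨ arith₁ k ⟩
      k + 5 * (k * k)                      ≤⟨ +-monoˡ-≤ _ k≤k² ⟩
      k * k + 5 * (k * k)                  ≤⟨ m≤m+n _ _ ⟩
      -- Slack, only to reach the constant 22 of the other case.
      k * k + 5 * (k * k) + 16 * (k * k)   ≡⟨ arith₂ k ⟩
      22 * (k * k)                         ≤⟨ *-monoʳ-≤ 22 (*-monoʳ-≤ k (m≤m*n k r)) ⟩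
      22 * (k * (k * r))                   ∎
      where
      arith₁ : ∀ k → k * suc k + 4 * (k * k) ≡ k + 5 * (k * k)
      arith₁ = solve-∀
      arith₂ : ∀ k → k * k + 5 * (k * k) + 16 * (k * k) ≡ 22 * (k * k)
      arith₂ = solve-∀

  -- If the expanding part `S` is nonempty, some `x` in it has at most twice the average bounds for
  -- excluded vertices and for cherries. At least kr vertices of its link each start r⁴ cherries,
  -- and 8k³ ≤ kr⁵ exceeds the allowed 4k³.
  K₄-free-bound : K₄-free → n ≤ 22 * (k * (k * r))
  K₄-free-bound K₄-free =
    -- 21 = 1 + 16 + 4: a neighbourhood loses at most 16kr excluded vertices and k(1 + 3r) ≤ 4kr
    -- vertices to make it expanding, and kr must remain.
    let (S , _ , n≤ , S-exp) = expanding-subset k α<k full (21 * (k * r)) in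
    bound S (subst (_≤ ∣ S ∣ + k * suc (21 * (k * r))) (∣⊤∣≡n n) n≤) S-exp
    where
    open ≤-Reasoning
    bound : ∀ S → n ≤ ∣ S ∣ + k * suc (21 * (k * r)) → Expanding S (21 * (k * r)) → n ≤ 22 * (k * (k * r))
    bound S n≤ S-exp with nonempty? S
    ... | no empty = begin
      n                                      ≤⟨ empty-bound S empty n≤ ⟩
      k * suc (21 * (k * r))                 ≤⟨ *-monoʳ-≤ k (+-monoˡ-≤ _ 1≤kr) ⟩
      k * (k * r + 21 * (k * r))             ≡⟨ arith k (k * r) ⟩
      22 * (k * (k * r))                     ∎
      where
      1≤kr : 1 ≤ k * r
      1≤kr = >-nonZero⁻¹ (k * r)
      arith : ∀ k z → k * (z + 21 * z) ≡ 22 * (k * z)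
      arith = solve-∀
    ... | yes nonempty =
      let (x , x∈ , ∣X∣≤ , cherries≤) = average₂ S (λ x → ∣ excluded x ∣) cherries (8 * (k * r)) (k * (k * (2 * k)))
            (>-nonZero⁻¹ _ {{m*n≢0 k _ {{k≢0}} {{m*n≢0 k _ {{k≢0}} {{m*n≢0 2 k}}}}}}) nonempty (>-nonZero⁻¹ _ {{m*n≢0 8 (k * r)}})
            ∑-excluded≤ ∑-cherries≤
          (L , L⊆ , ∣D─X∣≤ , L-exp) = expanding-subset k α<k (D x ─ excluded x) (3 * r)
      in contradiction (too-few x x∈ ∣X∣≤ cherries≤ L L⊆ ∣D─X∣≤ L-exp) (<⇒≱ 4k³<8k³)
      where
      open Links G K₄-free (spindle-free α₇≥3 K₄-free) k α<k S using (D; ∈D⁻)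
      open Cherries G K₄-free (spindle-free α₇≥3 K₄-free) k α<k S r 1≤r 2k≤r³
        using (excluded; excluded?; cherries; ∑-excluded≤; ∑-cherries≤; nonfine; module Link)
      4k³<8k³ : 2 * (k * (k * (2 * k))) < k * (8 * (k * k))
      4k³<8k³ = begin-strict
        2 * (k * (k * (2 * k)))                    <⟨ m<m+n _ (>-nonZero⁻¹ _ {{m*n≢0 4 _ {{_}} {{m*n≢0 k _ {{k≢0}} {{m*n≢0 k k}}}}}}) ⟩
        2 * (k * (k * (2 * k))) + 4 * (k * (k * k)) ≡⟨ arith k ⟩
        k * (8 * (k * k))                          ∎
        where
        arith : ∀ k → 2 * (k * (k * (2 * k))) + 4 * (k * (k * k)) ≡ k * (8 * (k * k))
        arith = solve-∀
      too-few : ∀ x → x ∈ S → ∣ excluded x ∣ ≤ 2 * (8 * (k * r)) → cherries x ≤ 2 * (k * (k * (2 * k))) →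
        ∀ L → L ⊆ D x ─ excluded x → ∣ D x ─ excluded x ∣ ≤ ∣ L ∣ + k * suc (3 * r) → Expanding L (3 * r) →
        k * (8 * (k * k)) ≤ 2 * (k * (k * (2 * k)))
      too-few x x∈ ∣X∣≤ cherries≤ L L⊆ ∣D─X∣≤ L-exp = begin
        k * (8 * (k * k))                    ≤⟨ *-monoʳ-≤ k 8k²≤r⁵ ⟩
        k * r ^ 5                            ≡⟨ trans (cong (k *_) (fifth-power r)) (sym (*-assoc k r _)) ⟩
        k * r * (r * (r * (r * r)))          ≤⟨ *-monoˡ-≤ (r * (r * (r * r))) kr≤∣L∣ ⟩
        ∣ L ∣ * (r * (r * (r * r)))          ≤⟨ Link.∣L∣r⁴≤cherries x x∈ L (proj₁ ∘ ∈─⁻ ∘ L⊆) fine L-exp ⟩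
        cherries x                           ≤⟨ cherries≤ ⟩
        2 * (k * (k * (2 * k)))              ∎
        where
        fine : ∀ {v} → v ∈ L → x ∉ nonfine v
        fine v∈ x∈nf = let (v∈D , v∉X) = ∈─⁻ (L⊆ v∈) in v∉X (∈⟦⟧⁺ (excluded? x) (proj₂ (∈D⁻ v∈D) , x∈nf))
        arith₁ : ∀ k r → k * r + 20 * (k * r) ≡ 21 * (k * r)
        arith₁ = solve-∀
        arith₂ : ∀ l k r → l + k * (r + 3 * r) + 2 * (8 * (k * r)) ≡ l + 20 * (k * r)
        arith₂ = solve-∀
        kr≤∣L∣ : k * r ≤ ∣ L ∣
        kr≤∣L∣ = +-cancelʳ-≤ (20 * (k * r)) _ _ (begin
          k * r + 20 * (k * r)                              ≡⟨ arith₁ k r ⟩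
          21 * (k * r)                                      ≤⟨ degree≥ S-exp x∈ ⟩
          ∣ D x ∣                                           ≤⟨ ∣∣≤∣─∣+∣∣ (D x) (excluded x) ⟩
          ∣ D x ─ excluded x ∣ + ∣ excluded x ∣             ≤⟨ +-mono-≤ ∣D─X∣≤ ∣X∣≤ ⟩
          ∣ L ∣ + k * suc (3 * r) + 2 * (8 * (k * r))       ≤⟨ +-monoˡ-≤ _ (+-monoʳ-≤ (∣ L ∣) (*-monoʳ-≤ k (+-monoˡ-≤ (3 * r) 1≤r))) ⟩
          ∣ L ∣ + k * (r + 3 * r) + 2 * (8 * (k * r))       ≡⟨ arith₂ (∣ L ∣) k r ⟩
          ∣ L ∣ + 20 * (k * r)                              ∎)

  order-bound : n ≤ 22 * (k * (k * r))
  order-bound with Fin.any? (λ a → Fin.any? λ b → Fin.any? λ c → Fin.any? λ d →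
    (a ~? b) ×-dec (a ~? c) ×-dec (a ~? d) ×-dec (b ~? c) ×-dec (b ~? d) ×-dec (c ~? d))
  ... | yes (_ , _ , _ , _ , ab , ac , ad , bc , bd , cd) = K₄-bound ab ac ad bc bd cd
  ... | no none = K₄-free-bound λ ab ac ad bc bd cd → none (_ , _ , _ , _ , ab , ac , ad , bc , bd , cd)

-- From the order bound to the exponent 5/12

^-distribʳ-* : ∀ m n o → (m * n) ^ o ≡ m ^ o * n ^ o
^-distribʳ-* m n zero    = refl
^-distribʳ-* m n (suc o) = trans (cong (m * n *_) (^-distribʳ-* m n o)) (arith m n (m ^ o) (n ^ o))
  where
  arith : ∀ a b c d → a * b * (c * d) ≡ a * c * (b * d)
  arith = solve-∀

-- A root up to a constant factor is enough. By induction, `r` is kept while `r ^ 5` is large enough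
-- and doubled otherwise, which multiplies `r ^ 5` by 32.
fifth-root : ∀ m → ∃ λ r → 1 ≤ r × m ≤ r ^ 5 × r ^ 5 ≤ 32 * suc m
fifth-root zero = 1 , ≤-refl , z≤n , s≤s z≤n
fifth-root (suc m) with r , 1≤r , m≤ , ≤32m ← fifth-root m | suc m ≤? r ^ 5
... | yes m< = r , 1≤r , m< , ≤-trans ≤32m (*-monoʳ-≤ 32 (n≤1+n (suc m)))
... | no  m≮ = 2 * r , ≤-trans 1≤r (m≤m+n r _) , (begin
    suc m            ≤⟨ s≤s m≤ ⟩
    1 + r ^ 5        ≤⟨ +-monoˡ-≤ (r ^ 5) (^-monoˡ-≤ 5 1≤r) ⟩
    r ^ 5 + r ^ 5    ≤⟨ m≤m+n _ _ ⟩
    r ^ 5 + r ^ 5 + 30 * r ^ 5  ≡⟨ arith₁ (r ^ 5) ⟩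
    32 * r ^ 5       ≡⟨ sym (^-distribʳ-* 2 r 5) ⟩
    (2 * r) ^ 5      ∎) , (begin
    (2 * r) ^ 5      ≡⟨ ^-distribʳ-* 2 r 5 ⟩
    32 * r ^ 5       ≤⟨ *-monoʳ-≤ 32 (≤-trans (≤-pred (≰⇒> m≮)) (≤-trans (n≤1+n m) (n≤1+n _))) ⟩
    32 * suc (suc m) ∎)
    where
    open ≤-Reasoning
    arith₁ : ∀ z → z + z + 30 * z ≡ 32 * z
    arith₁ = solve-∀

opaque
  maximum-independent : (G : Graph n) → Σ (Subset n) λ S → Independent G S × (∀ I → Independent G I → ∣ I ∣ ≤ ∣ S ∣)
  maximum-independent {n} G = go n ∅ ∅-independent (m≤m+n n _)
    where
    open Neighbourhoods G
    go : ∀ fuel S → Independent G S → n ≤ fuel + ∣ S ∣ →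
      Σ (Subset n) λ S → Independent G S × (∀ I → Independent G I → ∣ I ∣ ≤ ∣ S ∣)
    go fuel S S-ind n≤ with anySubset? (λ I → independent? I ×-dec (∣ S ∣ <? ∣ I ∣))
    ... | no none = S , S-ind , λ I I-ind → ≮⇒≥ λ S<I → none (I , I-ind , S<I)
    -- An independent set larger than `S` would now have more than `n` vertices.
    go zero S S-ind n≤ | yes (I , _ , S<I) = contradiction (∣p∣≤n I) (<⇒≱ (≤-<-trans n≤ S<I))
    go (suc fuel) S S-ind n≤ | yes (I , I-ind , S<I) =
      go fuel I I-ind (≤-trans n≤ (≤-trans (≤-reflexive (sym (+-suc fuel (∣ S ∣)))) (+-monoʳ-≤ fuel S<I)))

-- The numerical constants are kept abstract here, since Agda would unfold products with literals.
combine-bounds : ∀ a e f t {n k r m} → 1 ≤ k → n ≤ a * (k * (k * r)) → r ^ 5 ≤ e * suc (f * (k * k)) → k ≤ t * m →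
  n ^ 5 ≤ a ^ 5 * (e * suc f) * t ^ 12 * m ^ 12
combine-bounds a e f t {n} {k} {r} {m} 1≤k n≤ r⁵≤ k≤tm = begin
  n ^ 5                                       ≤⟨ ^-monoˡ-≤ 5 n≤ ⟩
  (a * (k * (k * r))) ^ 5                     ≡⟨ ^-distribʳ-* a _ 5 ⟩
  a ^ 5 * (k * (k * r)) ^ 5                   ≡⟨ cong (a ^ 5 *_) k²r^5 ⟩
  a ^ 5 * (k ^ 10 * r ^ 5)                    ≤⟨ *-monoʳ-≤ (a ^ 5) (*-monoʳ-≤ (k ^ 10) r⁵≤) ⟩
  a ^ 5 * (k ^ 10 * (e * suc (f * (k * k))))  ≤⟨ *-monoʳ-≤ (a ^ 5) (*-monoʳ-≤ (k ^ 10) (*-monoʳ-≤ e (+-monoˡ-≤ _ (*-mono-≤ 1≤k 1≤k)))) ⟩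
  a ^ 5 * (k ^ 10 * (e * (k * k + f * (k * k)))) ≡⟨ collect₁ (a ^ 5) (k ^ 10) e f (k * k) ⟩
  a ^ 5 * (e * suc f) * (k ^ 10 * (k * k))    ≡⟨ cong (λ z → a ^ 5 * (e * suc f) * (k ^ 10 * (k * z))) (sym (*-identityʳ k)) ⟩
  a ^ 5 * (e * suc f) * (k ^ 10 * k ^ 2)      ≡⟨ cong (a ^ 5 * (e * suc f) *_) (sym (^-distribˡ-+-* k 10 2)) ⟩
  a ^ 5 * (e * suc f) * k ^ 12                ≤⟨ *-monoʳ-≤ (a ^ 5 * (e * suc f)) (^-monoˡ-≤ 12 k≤tm) ⟩
  a ^ 5 * (e * suc f) * (t * m) ^ 12          ≡⟨ cong (a ^ 5 * (e * suc f) *_) (^-distribʳ-* t m 12) ⟩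
  a ^ 5 * (e * suc f) * (t ^ 12 * m ^ 12)     ≡⟨ sym (*-assoc (a ^ 5 * (e * suc f)) (t ^ 12) (m ^ 12)) ⟩
  a ^ 5 * (e * suc f) * t ^ 12 * m ^ 12       ∎
  where
  open ≤-Reasoning
  collect₁ : ∀ a c e f b → a * (c * (e * (b + f * b))) ≡ a * (e * suc f) * (c * b)
  collect₁ = solve-∀
  k²r^5 : (k * (k * r)) ^ 5 ≡ k ^ 10 * r ^ 5
  k²r^5 = begin-equality
    (k * (k * r)) ^ 5       ≡⟨ ^-distribʳ-* k (k * r) 5 ⟩
    k ^ 5 * (k * r) ^ 5     ≡⟨ cong (k ^ 5 *_) (^-distribʳ-* k r 5) ⟩
    k ^ 5 * (k ^ 5 * r ^ 5) ≡⟨ sym (*-assoc (k ^ 5) (k ^ 5) (r ^ 5)) ⟩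
    k ^ 5 * k ^ 5 * r ^ 5   ≡⟨ cong (_* r ^ 5) (sym (^-distribˡ-+-* k 5 5)) ⟩
    k ^ 10 * r ^ 5          ∎

opaque
  fifth-power-bound : ∃ λ c → ∀ n (G : Graph n) → Alpha7≥3 G → (S : Subset n) → (∀ I → Independent G I → ∣ I ∣ ≤ ∣ S ∣) →
    -- The factors come from n ≤ 22k²r, from r⁵ ≤ 32(8k² + 1) ≤ 32 · 9k², and from k ≤ 2∣S∣ raised
    -- to the power 12.
    1 ≤ ∣ S ∣ → n ^ 5 ≤ c * ∣ S ∣ ^ 12
  fifth-power-bound = 22 ^ 5 * (32 * suc 8) * 2 ^ 12 , λ n G α₇≥3 S max 1≤m →
    let k = suc (∣ S ∣)
        (r , 1≤r , 8k²≤r⁵ , r⁵≤) = fifth-root (8 * (k * k))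
        k≤2m = ≤-trans (+-monoˡ-≤ (∣ S ∣) 1≤m) (≤-reflexive (cong (∣ S ∣ +_) (sym (+-identityʳ (∣ S ∣)))))
    in combine-bounds 22 32 8 2 {n} {k} {r} {∣ S ∣} (s≤s z≤n)
         (OrderBound.order-bound G α₇≥3 k (λ I I-ind → s≤s (max I I-ind)) r 1≤r 8k²≤r⁵) r⁵≤ k≤2m

-- Raise `n ^ 5 ≤ c * m ^ 12` to the power `B`. The constant `c ^ B` is at most `n`, hence at most
-- `n ^ (12 * A)`, which is then cancelled.
power-bound : ∀ c A B n m → 1 ≤ A → 1 ≤ m → c ^ B ≤ n → 1 ≤ n → n ^ 5 ≤ c * m ^ 12 → n ^ (5 * B ∸ 12 * A) ≤ m ^ (12 * B)
power-bound c A B n m 1≤A 1≤m cᴮ≤n 1≤n n⁵≤ with 12 * A ≤? 5 * B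
-- Truncated subtraction makes the exponent 0 when A/B exceeds 5/12.
... | no 12A≰ = subst (λ e → n ^ e ≤ m ^ (12 * B)) (sym (m≤n⇒m∸n≡0 (<⇒≤ (≰⇒> 12A≰)))) (m^n>0 m {{>-nonZero 1≤m}} (12 * B))
... | yes 12A≤ = *-cancelʳ-≤ _ _ (n ^ (12 * A)) {{m^n≢0 n (12 * A) {{>-nonZero 1≤n}}}} (begin
    n ^ (5 * B ∸ 12 * A) * n ^ (12 * A)   ≡⟨ sym (^-distribˡ-+-* n (5 * B ∸ 12 * A) (12 * A)) ⟩
    n ^ (5 * B ∸ 12 * A + 12 * A)         ≡⟨ cong (n ^_) (m∸n+n≡m 12A≤) ⟩
    n ^ (5 * B)                           ≡⟨ sym (^-*-assoc n 5 B) ⟩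
    (n ^ 5) ^ B                           ≤⟨ ^-monoˡ-≤ B n⁵≤ ⟩
    (c * m ^ 12) ^ B                      ≡⟨ ^-distribʳ-* c (m ^ 12) B ⟩
    c ^ B * (m ^ 12) ^ B                  ≡⟨ cong (c ^ B *_) (^-*-assoc m 12 B) ⟩
    c ^ B * m ^ (12 * B)                  ≤⟨ *-monoˡ-≤ _ (≤-trans cᴮ≤n n≤n^12A) ⟩
    n ^ (12 * A) * m ^ (12 * B)           ≡⟨ *-comm (n ^ (12 * A)) _ ⟩
    m ^ (12 * B) * n ^ (12 * A)           ∎)
    where
    open ≤-Reasoning
    n≤n^12A : n ≤ n ^ (12 * A)
    n≤n^12A = ≤-trans (≤-reflexive (sym (^-identityʳ n)))
      (^-monoʳ-≤ n {{>-nonZero 1≤n}} (≤-trans 1≤A (m≤n*m A 12)))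

-- Here ε = `suc a / suc b`; the inequality ∣S∣ ≥ n^(5/12 - ε) is raised to the power `12 * suc b`
-- to have natural exponents.
theorem1p3 : (a b : ℕ) → Σ ℕ λ n₀ → (n : ℕ) → n₀ ≤ n → (G : Graph n) → Alpha7≥3 G →
    Σ (Subset n) λ S → Independent G S ×
    n ^ (5 * suc b ∸ 12 * suc a) ≤ ∣ S ∣ ^ (12 * suc b)
-- This `n₀` gives `c ^ suc b ≤ n`, and the added 1 rules out `n = 0`, so that there is a vertex and
-- `S` is nonempty.
theorem1p3 a b = let (c , bound) = fifth-power-bound in suc (c ^ suc b) , λ where
  n@(suc _) n₀≤n G α₇≥3 →
    let (S , S-ind , max) = maximum-independent G
        v = zero {n = pred n}
        1≤∣S∣ = ≤-trans (∈⇒1≤∣∣ (x∈⁅x⁆ v)) (max ⁅ v ⁆ (Neighbourhoods.⁅⁆-independent G v))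
    in S , S-ind , power-bound c (suc a) (suc b) n (∣ S ∣) (s≤s z≤n) 1≤∣S∣ (≤-trans (n≤1+n _) n₀≤n) (s≤s z≤n) (bound n G α₇≥3 S max 1≤∣S∣)
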